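{- Let $L:\mathscr A\to\mathscr B$, $R:\mathscr B\to\mathscr A$ be functors between categories with $L\dashv R$, where $\mathscr A$ is symmetric monoidal and the monad $R\circ L$ is strong. Let $\mathrm{Lin}:\mathscr M\to\mathscr A$ and $\mathrm{Mult}:\mathscr B\to\mathscr M$ form an $R$-relative linear-non-linear coadjunction. Then it induces a direct linear-non-linear adjunction between $\mathscr M$ and $\mathbf{dupl}_{L,R}$, with left adjoint $\mathrm{Lin}:\mathscr M\to\mathbf{dupl}_{L,R}$ and right adjoint $\mathrm{Mult}^-:\mathbf{dupl}_{L,R}\rightharpoonup\mathscr M$: that is, $(\mathrm{Lin},\mathrm{Mult}^-)$ is a positive adjunction, and the induced functor $\mathrm{Lin}:\mathscr M\to\mathscr P_t$ into the category $\mathscr P_t$ of positive objects and thunkable morphisms of $\mathbf{dupl}_{L,R}$ is strong monoidal (from the cartesian structure of $\mathscr M$ to the tensor product on $\mathscr P_t$).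
   Context: For a functor $R:\mathscr B\to\mathscr A$ with $\mathscr A$ symmetric monoidal, an $R$-relative linear-non-linear coadjunction consists of a category $\mathscr M$ with finite products, a strong monoidal functor $\mathrm{Lin}:\mathscr M\to\mathscr A$, a functor $\mathrm{Mult}:\mathscr B\to\mathscr M$, and bijections $\Psi_{X,B}:\mathscr A(\mathrm{Lin}X,RB)\cong\mathscr M(X,\mathrm{Mult}B)$ natural in $X$ and $B$. A non-associative category is a category without the associativity axiom. A bare functor $\rightharpoonup$ is a morphism of reflexive graphs (preserves identities, not necessarily composition). A morphism $f$ is thunkable if $(h\circ g)\circ f=h\circ(g\circ f)$ for all composable $g,h$; $h$ is linear if $(h\circ g)\circ f=h\circ(g\circ f)$ for all composable $f,g$. An object is positive if every morphism out of it is linear. An adjunction over non-associative categories $\mathscr D,\mathscr E$: bare functors $F:\mathscr D\rightharpoonup\mathscr E$, $G:\mathscr E\rightharpoonup\mathscr D$ with bijections $\varphi:\mathscr E(FA,B)\cong\mathscr D(A,GB)$ such that $\varphi(g\circ h)=Gg\circ\varphi(h)$ and $\varphi(h\circ Ff)=\varphi(h)\circ f$. It is positive if every $FA$ is positive. $\mathbf{dupl}_{L,R}$: objects $|\mathscr A|\uplus|\mathscr B|$; $X^+=X$, $X^-=LX$ for $X\in\mathscr A$ and $X^+=RX$, $X^-=X$ for $X\in\mathscr B$; $\mathbf{dupl}_{L,R}(X,Y)=\mathscr A(X^+,RY^-)$; the identity on $X$ is the unit $\eta_X$ if $X\in\mathscr A$, and $\mathrm{id}_{RX}$ if $X\in\mathscr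 B$; the composite of $f:X\to Z$ and $g:Z\to Y$ is $R(\hat g)\circ f$ if $Z\in\mathscr A$ ($\hat g:LZ\to Y^-$ the transpose of $g$) and $g\circ f$ if $Z\in\mathscr B$. Tensor product on $\mathbf{dupl}_{L,R}$ and on $\mathscr P_t$: $X\otimes Y:=X^+\otimes Y^+\in|\mathscr A|$, with unit the unit of $\mathscr A$. For $f\in\mathbf{dupl}_{L,R}(X,X')$ let $f^{\circ}:X^+\to RLX'^+$ be $f$ if $X'\in\mathscr A$, and $\eta_{RX'}\circ f$ if $X'\in\mathscr B$; for thunkable $f,g$, $f\otimes g$ is $f^\circ\otimes g^\circ$ followed by the double strength $RLX'^+\otimes RLY'^+\to RL(X'^+\otimes Y'^+)$ of the strong monad $RL$ (the choice of evaluation order is irrelevant for thunkable maps). This makes $\mathscr P_t$ a symmetric monoidal category. $\mathrm{Lin}:\mathscr M\to\mathbf{dupl}_{L,R}$ sends $X$ to $\mathrm{Lin}X\in|\mathscr A|$ and $f:X\to X'$ to $\eta_{\mathrm{Lin}X'}\circ\mathrm{Lin}f$. $\mathrm{Mult}^-X=\mathrm{Mult}(X^-)$; for $f\in\mathscr A(X^+,RY^-)$, $\mathrm{Mult}^-f=\mathrm{Mult}(\hat f)$ if $X\in\mathscr A$, and $\mathrm{Mult}^-f=\Psi_{\mathrm{Mult}X,Y^- }(f\circ\varepsilon_X)$ if $X\in\mathscr B$, where $\varepsilon_X=\Psi^{ -1}(\mathrm{id}_{\mathrm{Mult}X}):\mathrm{Lin}\,\mathrm{Mult}X\to RX$. 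-}

module Defs where

open import Level using (Level; _⊔_; suc)
open import Data.Sum.Base using (_⊎_; inj₁; inj₂)
open import Function.Bundles using (Inverse)
open import Relation.Binary.Bundles using (Setoid)
open import Relation.Binary.Structures using (IsEquivalence)
import Relation.Binary.Reasoning.Setoid as SetoidReasoning

-- Every hom-set is a setoid and equality of morphisms is the setoid equality
-- _≈_; there is no equality of objects.

record NonAssocCategory (o ℓ e : Level) : Set (suc (o ⊔ ℓ ⊔ e)) where
  infix  4 _≈_ _⇒_
  infixr 9 _∘_
  field
    Obj       : Set o
    _⇒_       : Obj → Obj → Set ℓ
    _≈_       : ∀ {X Y} → X ⇒ Y → X ⇒ Y → Set e
    id        : ∀ {X} → X ⇒ X
    _∘_       : ∀ {X Y Z} → Y ⇒ Z → X ⇒ Y → X ⇒ Z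
    equiv     : ∀ {X Y} → IsEquivalence (_≈_ {X} {Y})
    identityˡ : ∀ {X Y} {f : X ⇒ Y} → id ∘ f ≈ f
    identityʳ : ∀ {X Y} {f : X ⇒ Y} → f ∘ id ≈ f
    ∘-resp-≈  : ∀ {X Y Z} {g g′ : Y ⇒ Z} {f f′ : X ⇒ Y} →
                g ≈ g′ → f ≈ f′ → g ∘ f ≈ g′ ∘ f′

  hom-setoid : Obj → Obj → Setoid ℓ e
  hom-setoid X Y = record { Carrier = X ⇒ Y ; _≈_ = _≈_ ; isEquivalence = equiv }

  module ≈ {X Y : Obj} = IsEquivalence (equiv {X} {Y})
  module ≈-Reasoning {X Y : Obj} = SetoidReasoning (hom-setoid X Y)

  ∘-resp-≈ˡ : ∀ {X Y Z} {g g′ : Y ⇒ Z} {f : X ⇒ Y} → g ≈ g′ → g ∘ f ≈ g′ ∘ f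
  ∘-resp-≈ˡ p = ∘-resp-≈ p ≈.refl

  ∘-resp-≈ʳ : ∀ {X Y Z} {g : Y ⇒ Z} {f f′ : X ⇒ Y} → f ≈ f′ → g ∘ f ≈ g ∘ f′
  ∘-resp-≈ʳ p = ∘-resp-≈ ≈.refl p

  Thunkable : ∀ {X Y} → X ⇒ Y → Set (o ⊔ ℓ ⊔ e)
  Thunkable {X} {Y} f = ∀ {Z W} (g : Y ⇒ Z) (h : Z ⇒ W) → (h ∘ g) ∘ f ≈ h ∘ (g ∘ f)

  Linear : ∀ {X Y} → X ⇒ Y → Set (o ⊔ ℓ ⊔ e)
  Linear {X} {Y} h = ∀ {V W} (f : V ⇒ W) (g : W ⇒ X) → (h ∘ g) ∘ f ≈ h ∘ (g ∘ f)

  Positive : Obj → Set (o ⊔ ℓ ⊔ e)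
  Positive X = ∀ {Y} (h : X ⇒ Y) → Linear h

record Category (o ℓ e : Level) : Set (suc (o ⊔ ℓ ⊔ e)) where
  field
    nonAssoc : NonAssocCategory o ℓ e
  open NonAssocCategory nonAssoc public
  field
    assoc : ∀ {W X Y Z} {f : W ⇒ X} {g : X ⇒ Y} {h : Y ⇒ Z} →
            (h ∘ g) ∘ f ≈ h ∘ (g ∘ f)

  sym-assoc : ∀ {W X Y Z} {f : W ⇒ X} {g : X ⇒ Y} {h : Y ⇒ Z} →
              h ∘ (g ∘ f) ≈ (h ∘ g) ∘ f
  sym-assoc = ≈.sym assoc

  pullˡ : ∀ {W X Y Z} {f : W ⇒ X} {g : X ⇒ Y} {h : Y ⇒ Z} {k : X ⇒ Z} →
          h ∘ g ≈ k → h ∘ (g ∘ f) ≈ k ∘ f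
  pullˡ p = ≈.trans sym-assoc (∘-resp-≈ˡ p)

  pullʳ : ∀ {W X Y Z} {f : W ⇒ X} {g : X ⇒ Y} {h : Y ⇒ Z} {k : W ⇒ Y} →
          g ∘ f ≈ k → (h ∘ g) ∘ f ≈ h ∘ k
  pullʳ p = ≈.trans assoc (∘-resp-≈ʳ p)

  infix 4 _≅_
  record _≅_ (X Y : Obj) : Set (ℓ ⊔ e) where
    field
      from : X ⇒ Y
      to   : Y ⇒ X
      isoˡ : to ∘ from ≈ id
      isoʳ : from ∘ to ≈ id

record BareFunctor {o ℓ e o′ ℓ′ e′ : Level}
                   (C : NonAssocCategory o ℓ e) (D : NonAssocCategory o′ ℓ′ e′) :
                   Set (o ⊔ ℓ ⊔ e ⊔ o′ ⊔ ℓ′ ⊔ e′) where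
  private
    module C = NonAssocCategory C
    module D = NonAssocCategory D
  field
    F₀       : C.Obj → D.Obj
    F₁       : ∀ {X Y} → X C.⇒ Y → F₀ X D.⇒ F₀ Y
    F-resp-≈ : ∀ {X Y} {f g : X C.⇒ Y} → f C.≈ g → F₁ f D.≈ F₁ g
    F-id     : ∀ {X} → F₁ (C.id {X}) D.≈ D.id

record Functor {o ℓ e o′ ℓ′ e′ : Level} (C : Category o ℓ e) (D : Category o′ ℓ′ e′) :
               Set (o ⊔ ℓ ⊔ e ⊔ o′ ⊔ ℓ′ ⊔ e′) where
  private
    module C = Category C
    module D = Category D
  field
    bare : BareFunctor C.nonAssoc D.nonAssoc
  open BareFunctor bare public
  field
    F-∘ : ∀ {X Y Z} {f : X C.⇒ Y} {g : Y C.⇒ Z} → F₁ (g C.∘ f) D.≈ F₁ g D.∘ F₁ f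

-- For functors between categories this is the usual notion of adjunction.
record Adjunction {o ℓ e o′ ℓ′ e′ : Level}
                  {D : NonAssocCategory o ℓ e} {E : NonAssocCategory o′ ℓ′ e′}
                  (F : BareFunctor D E) (G : BareFunctor E D) :
                  Set (o ⊔ ℓ ⊔ e ⊔ o′ ⊔ ℓ′ ⊔ e′) where
  private
    module D = NonAssocCategory D
    module E = NonAssocCategory E
    module F = BareFunctor F
    module G = BareFunctor G
  field
    φ : ∀ A B → Inverse (E.hom-setoid (F.F₀ A) B) (D.hom-setoid A (G.F₀ B))

  ♯ : ∀ {A B} → F.F₀ A E.⇒ B → A D.⇒ G.F₀ B
  ♯ {A} {B} = Inverse.to (φ A B)

  ♭ : ∀ {A B} → A D.⇒ G.F₀ B → F.F₀ A E.⇒ B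
  ♭ {A} {B} = Inverse.from (φ A B)

  field
    φ-naturalʳ : ∀ {A B C} (g : B E.⇒ C) (h : F.F₀ A E.⇒ B) →
                 ♯ (g E.∘ h) D.≈ G.F₁ g D.∘ ♯ h
    φ-naturalˡ : ∀ {A A′ B} (h : F.F₀ A E.⇒ B) (f : A′ D.⇒ A) →
                 ♯ (h E.∘ F.F₁ f) D.≈ ♯ h D.∘ f

  η : ∀ {A} → A D.⇒ G.F₀ (F.F₀ A)
  η = ♯ E.id

  ♯-cong : ∀ {A B} {g h : F.F₀ A E.⇒ B} → g E.≈ h → ♯ g D.≈ ♯ h
  ♯-cong {A} {B} = Inverse.to-cong (φ A B)

  ♭-cong : ∀ {A B} {g h : A D.⇒ G.F₀ B} → g D.≈ h → ♭ g E.≈ ♭ h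
  ♭-cong {A} {B} = Inverse.from-cong (φ A B)

  ♯♭ : ∀ {A B} (g : A D.⇒ G.F₀ B) → ♯ (♭ g) D.≈ g
  ♯♭ {A} {B} = Inverse.strictlyInverseˡ (φ A B)

  ♭♯ : ∀ {A B} (g : F.F₀ A E.⇒ B) → ♭ (♯ g) E.≈ g
  ♭♯ {A} {B} = Inverse.strictlyInverseʳ (φ A B)

  ♯-injective : ∀ {A B} {g h : F.F₀ A E.⇒ B} → ♯ g D.≈ ♯ h → g E.≈ h
  ♯-injective {g = g} {h} p = E.≈.trans (E.≈.sym (♭♯ g)) (E.≈.trans (♭-cong p) (♭♯ h))

IsPositive : ∀ {o ℓ e o′ ℓ′ e′} {D : NonAssocCategory o ℓ e} {E : NonAssocCategory o′ ℓ′ e′} →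
             BareFunctor D E → Set (o ⊔ o′ ⊔ ℓ′ ⊔ e′)
IsPositive {E = E} F = ∀ A → NonAssocCategory.Positive E (BareFunctor.F₀ F A)

module _ {o ℓ e : Level} (D : NonAssocCategory o ℓ e) where
  open NonAssocCategory D

  record PositiveObj : Set (o ⊔ ℓ ⊔ e) where
    constructor _,⁺_
    field
      obj      : Obj
      positive : Positive obj
  open PositiveObj

  record ThunkableHom (X Y : PositiveObj) : Set (o ⊔ ℓ ⊔ e) where
    constructor _,ᵗ_
    field
      hom       : obj X ⇒ obj Y
      thunkable : Thunkable hom
  open ThunkableHom

  id-thunkable : ∀ {X} → Thunkable (id {X})
  id-thunkable g h = ≈.trans identityʳ (∘-resp-≈ʳ (≈.sym identityʳ))

  ∘-thunkable : ∀ {X Y Z} {g : Y ⇒ Z} {f : X ⇒ Y} →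
                Thunkable g → Thunkable f → Thunkable (g ∘ f)
  ∘-thunkable {g = g} {f} g-th f-th h k = begin
    (k ∘ h) ∘ (g ∘ f)  ≈⟨ f-th g (k ∘ h) ⟨
    ((k ∘ h) ∘ g) ∘ f  ≈⟨ ∘-resp-≈ˡ (g-th h k) ⟩
    (k ∘ (h ∘ g)) ∘ f  ≈⟨ f-th (h ∘ g) k ⟩
    k ∘ ((h ∘ g) ∘ f)  ≈⟨ ∘-resp-≈ʳ (f-th g h) ⟩
    k ∘ (h ∘ (g ∘ f))  ∎
    where open ≈-Reasoning

  𝒫ₜ : Category (o ⊔ ℓ ⊔ e) (o ⊔ ℓ ⊔ e) e
  𝒫ₜ = record
    { nonAssoc = record
      { Obj       = PositiveObj
      ; _⇒_       = ThunkableHom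
      ; _≈_       = λ f g → hom f ≈ hom g
      ; id        = id ,ᵗ id-thunkable
      ; _∘_       = λ g f → (hom g ∘ hom f) ,ᵗ ∘-thunkable (thunkable g) (thunkable f)
      ; equiv     = record { refl = ≈.refl ; sym = ≈.sym ; trans = ≈.trans }
      ; identityˡ = identityˡ
      ; identityʳ = identityʳ
      ; ∘-resp-≈  = ∘-resp-≈
      }
    ; assoc = λ {_} {_} {_} {_} {f} {g} {h} → thunkable f (hom g) (hom h)
    }

module _ {o ℓ e o′ ℓ′ e′ : Level} (C : Category o ℓ e) {D : NonAssocCategory o′ ℓ′ e′}
         {F : BareFunctor (Category.nonAssoc C) D} {G : BareFunctor D (Category.nonAssoc C)}
         (F⊣G : Adjunction F G) where
  private
    module C = Category C
    module D = NonAssocCategory D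
    module F = BareFunctor F
    module G = BareFunctor G
    open Adjunction F⊣G

  left-adjoint-thunkable : ∀ {X Y} (f : X C.⇒ Y) → D.Thunkable (F.F₁ f)
  left-adjoint-thunkable f g h = ♯-injective (begin
    ♯ ((h D.∘ g) D.∘ F.F₁ f)       ≈⟨ φ-naturalˡ (h D.∘ g) f ⟩
    ♯ (h D.∘ g) C.∘ f              ≈⟨ C.∘-resp-≈ˡ (φ-naturalʳ h g) ⟩
    (G.F₁ h C.∘ ♯ g) C.∘ f         ≈⟨ C.assoc ⟩
    G.F₁ h C.∘ (♯ g C.∘ f)         ≈⟨ C.∘-resp-≈ʳ (φ-naturalˡ g f) ⟨
    G.F₁ h C.∘ ♯ (g D.∘ F.F₁ f)    ≈⟨ φ-naturalʳ h (g D.∘ F.F₁ f) ⟨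
    ♯ (h D.∘ (g D.∘ F.F₁ f))       ∎)
    where open C.≈-Reasoning

  private
    ♯F : ∀ {X Y} (f : X C.⇒ Y) → ♯ (F.F₁ f) C.≈ η C.∘ f
    ♯F f = C.≈.trans (♯-cong (D.≈.sym D.identityˡ)) (φ-naturalˡ D.id f)

  left-adjoint-∘ : ∀ {X Y Z} {f : X C.⇒ Y} {g : Y C.⇒ Z} →
                   F.F₁ (g C.∘ f) D.≈ F.F₁ g D.∘ F.F₁ f
  left-adjoint-∘ {f = f} {g} = ♯-injective (begin
    ♯ (F.F₁ (g C.∘ f))       ≈⟨ ♯F (g C.∘ f) ⟩
    η C.∘ (g C.∘ f)          ≈⟨ C.sym-assoc ⟩
    (η C.∘ g) C.∘ f          ≈⟨ C.∘-resp-≈ˡ (♯F g) ⟨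
    ♯ (F.F₁ g) C.∘ f         ≈⟨ φ-naturalˡ (F.F₁ g) f ⟨
    ♯ (F.F₁ g D.∘ F.F₁ f)    ∎)
    where open C.≈-Reasoning

  inducedFunctor : IsPositive F → Functor C (𝒫ₜ D)
  inducedFunctor F-positive = record
    { bare = record
      { F₀       = λ X → F.F₀ X ,⁺ F-positive X
      ; F₁       = λ f → F.F₁ f ,ᵗ left-adjoint-thunkable f
      ; F-resp-≈ = F.F-resp-≈
      ; F-id     = F.F-id
      }
    ; F-∘ = left-adjoint-∘
    }

record Monoidal {o ℓ e : Level} (C : Category o ℓ e) : Set (o ⊔ ℓ ⊔ e) where
  open Category C
  infixr 10 _⊗₀_ _⊗₁_
  field
    unit     : Obj
    _⊗₀_     : Obj → Obj → Obj
    _⊗₁_     : ∀ {X X′ Y Y′} → X ⇒ X′ → Y ⇒ Y′ → X ⊗₀ Y ⇒ X′ ⊗₀ Y′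
    ⊗-resp-≈ : ∀ {X X′ Y Y′} {f f′ : X ⇒ X′} {g g′ : Y ⇒ Y′} →
               f ≈ f′ → g ≈ g′ → f ⊗₁ g ≈ f′ ⊗₁ g′
    ⊗-id     : ∀ {X Y} → id {X} ⊗₁ id {Y} ≈ id
    ⊗-∘      : ∀ {X X′ X″ Y Y′ Y″}
               {f : X ⇒ X′} {f′ : X′ ⇒ X″} {g : Y ⇒ Y′} {g′ : Y′ ⇒ Y″} →
               (f′ ∘ f) ⊗₁ (g′ ∘ g) ≈ (f′ ⊗₁ g′) ∘ (f ⊗₁ g)

    unitorˡ    : ∀ X → (unit ⊗₀ X) ≅ X
    unitorʳ    : ∀ X → (X ⊗₀ unit) ≅ X
    associator : ∀ X Y Z → ((X ⊗₀ Y) ⊗₀ Z) ≅ (X ⊗₀ (Y ⊗₀ Z))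

  λ⇒ : ∀ {X} → unit ⊗₀ X ⇒ X
  λ⇒ {X} = _≅_.from (unitorˡ X)

  ρ⇒ : ∀ {X} → X ⊗₀ unit ⇒ X
  ρ⇒ {X} = _≅_.from (unitorʳ X)

  α⇒ : ∀ {X Y Z} → (X ⊗₀ Y) ⊗₀ Z ⇒ X ⊗₀ (Y ⊗₀ Z)
  α⇒ {X} {Y} {Z} = _≅_.from (associator X Y Z)

  field
    unitorˡ-natural    : ∀ {X Y} {f : X ⇒ Y} → λ⇒ ∘ (id ⊗₁ f) ≈ f ∘ λ⇒
    unitorʳ-natural    : ∀ {X Y} {f : X ⇒ Y} → ρ⇒ ∘ (f ⊗₁ id) ≈ f ∘ ρ⇒
    associator-natural : ∀ {X X′ Y Y′ Z Z′} {f : X ⇒ X′} {g : Y ⇒ Y′} {h : Z ⇒ Z′} →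
                         α⇒ ∘ ((f ⊗₁ g) ⊗₁ h) ≈ (f ⊗₁ (g ⊗₁ h)) ∘ α⇒
    triangle : ∀ {X Y} → (id {X} ⊗₁ λ⇒ {Y}) ∘ α⇒ ≈ ρ⇒ ⊗₁ id
    pentagon : ∀ {W X Y Z} →
               (id {W} ⊗₁ α⇒ {X} {Y} {Z}) ∘ (α⇒ ∘ (α⇒ ⊗₁ id)) ≈ α⇒ ∘ α⇒

record SymmetricMonoidal {o ℓ e : Level} (C : Category o ℓ e) : Set (o ⊔ ℓ ⊔ e) where
  open Category C
  field
    monoidal : Monoidal C
  open Monoidal monoidal public
  field
    braid         : ∀ {X Y} → X ⊗₀ Y ⇒ Y ⊗₀ X
    braid-natural : ∀ {X X′ Y Y′} {f : X ⇒ X′} {g : Y ⇒ Y′} →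
                    braid ∘ (f ⊗₁ g) ≈ (g ⊗₁ f) ∘ braid
    braid-braid   : ∀ {X Y} → braid ∘ braid ≈ id {X ⊗₀ Y}
    hexagon       : ∀ {X Y Z} →
                    (id {Y} ⊗₁ braid {X} {Z}) ∘ (α⇒ ∘ (braid ⊗₁ id)) ≈ α⇒ ∘ (braid ∘ α⇒)

record StrongMonoidal {o ℓ e o′ ℓ′ e′ : Level} {C : Category o ℓ e} {D : Category o′ ℓ′ e′}
                      (MC : Monoidal C) (MD : Monoidal D) (F : Functor C D) :
                      Set (o ⊔ ℓ ⊔ e ⊔ o′ ⊔ ℓ′ ⊔ e′) where
  private
    module C = Category C
    module D = Category D
    module MC = Monoidal MC
    module MD = Monoidal MD
    module F = Functor F
  open D using (_∘_; _≈_; id; _≅_)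
  open F using (F₀; F₁)
  field
    unit-iso : MD.unit ≅ F₀ MC.unit
    ⊗-iso    : ∀ X Y → (F₀ X MD.⊗₀ F₀ Y) ≅ F₀ (X MC.⊗₀ Y)

  m₀ : MD.unit D.⇒ F₀ MC.unit
  m₀ = _≅_.from unit-iso

  m : ∀ {X Y} → F₀ X MD.⊗₀ F₀ Y D.⇒ F₀ (X MC.⊗₀ Y)
  m {X} {Y} = _≅_.from (⊗-iso X Y)

  field
    m-natural : ∀ {X X′ Y Y′} {f : X C.⇒ X′} {g : Y C.⇒ Y′} →
                m ∘ (F₁ f MD.⊗₁ F₁ g) ≈ F₁ (f MC.⊗₁ g) ∘ m
    m-assoc   : ∀ {X Y Z} → F₁ (MC.α⇒ {X} {Y} {Z}) ∘ (m ∘ (m MD.⊗₁ id))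
                            ≈ m ∘ ((id MD.⊗₁ m) ∘ MD.α⇒)
    m-unitˡ   : ∀ {X} → F₁ (MC.λ⇒ {X}) ∘ (m ∘ (m₀ MD.⊗₁ id)) ≈ MD.λ⇒
    m-unitʳ   : ∀ {X} → F₁ (MC.ρ⇒ {X}) ∘ (m ∘ (id MD.⊗₁ m₀)) ≈ MD.ρ⇒

record FiniteProducts {o ℓ e : Level} (C : Category o ℓ e) : Set (o ⊔ ℓ ⊔ e) where
  open Category C
  infixr 10 _×_ _×₁_
  field
    ⊤        : Obj
    !        : ∀ {X} → X ⇒ ⊤
    !-unique : ∀ {X} (f : X ⇒ ⊤) → ! ≈ f
    _×_      : Obj → Obj → Obj
    π₁       : ∀ {X Y} → X × Y ⇒ X
    π₂       : ∀ {X Y} → X × Y ⇒ Y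
    ⟨_,_⟩    : ∀ {X Y Z} → Z ⇒ X → Z ⇒ Y → Z ⇒ X × Y
    project₁ : ∀ {X Y Z} {f : Z ⇒ X} {g : Z ⇒ Y} → π₁ ∘ ⟨ f , g ⟩ ≈ f
    project₂ : ∀ {X Y Z} {f : Z ⇒ X} {g : Z ⇒ Y} → π₂ ∘ ⟨ f , g ⟩ ≈ g
    unique   : ∀ {X Y Z} {f : Z ⇒ X} {g : Z ⇒ Y} {h : Z ⇒ X × Y} →
               π₁ ∘ h ≈ f → π₂ ∘ h ≈ g → ⟨ f , g ⟩ ≈ h

  _×₁_ : ∀ {X X′ Y Y′} → X ⇒ X′ → Y ⇒ Y′ → X × Y ⇒ X′ × Y′
  f ×₁ g = ⟨ f ∘ π₁ , g ∘ π₂ ⟩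

  ×-ext : ∀ {X Y Z} {h k : Z ⇒ X × Y} → π₁ ∘ h ≈ π₁ ∘ k → π₂ ∘ h ≈ π₂ ∘ k → h ≈ k
  ×-ext p q = ≈.trans (≈.sym (unique p q)) (unique ≈.refl ≈.refl)

  !-unique₂ : ∀ {X} {f g : X ⇒ ⊤} → f ≈ g
  !-unique₂ {f = f} {g} = ≈.trans (≈.sym (!-unique f)) (!-unique g)

  ⟨⟩-cong : ∀ {X Y Z} {f f′ : Z ⇒ X} {g g′ : Z ⇒ Y} →
            f ≈ f′ → g ≈ g′ → ⟨ f , g ⟩ ≈ ⟨ f′ , g′ ⟩
  ⟨⟩-cong p q = unique (≈.trans project₁ (≈.sym p)) (≈.trans project₂ (≈.sym q))

  ⟨⟩∘ : ∀ {W X Y Z} {f : Z ⇒ X} {g : Z ⇒ Y} {h : W ⇒ Z} →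
        ⟨ f , g ⟩ ∘ h ≈ ⟨ f ∘ h , g ∘ h ⟩
  ⟨⟩∘ = ≈.sym (unique (pullˡ project₁) (pullˡ project₂))

  ×₁∘⟨⟩ : ∀ {X X′ Y Y′ Z} {f : X ⇒ X′} {g : Y ⇒ Y′} {h : Z ⇒ X} {k : Z ⇒ Y} →
          (f ×₁ g) ∘ ⟨ h , k ⟩ ≈ ⟨ f ∘ h , g ∘ k ⟩
  ×₁∘⟨⟩ = ≈.trans ⟨⟩∘ (⟨⟩-cong (pullʳ project₁) (pullʳ project₂))

  cartesianMonoidal : Monoidal C
  cartesianMonoidal = record
    { unit     = ⊤
    ; _⊗₀_     = _×_
    ; _⊗₁_     = _×₁_
    ; ⊗-resp-≈ = λ p q → ⟨⟩-cong (∘-resp-≈ˡ p) (∘-resp-≈ˡ q)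
    ; ⊗-id     = unique (≈.trans identityʳ (≈.sym identityˡ))
                        (≈.trans identityʳ (≈.sym identityˡ))
    ; ⊗-∘      = ≈.sym (≈.trans ×₁∘⟨⟩ (⟨⟩-cong sym-assoc sym-assoc))
    ; unitorˡ  = λ X → record
      { from = π₂
      ; to   = ⟨ ! , id ⟩
      ; isoˡ = ×-ext !-unique₂
                     (≈.trans (pullˡ project₂) (≈.trans identityˡ (≈.sym identityʳ)))
      ; isoʳ = project₂
      }
    ; unitorʳ  = λ X → record
      { from = π₁
      ; to   = ⟨ id , ! ⟩
      ; isoˡ = ×-ext (≈.trans (pullˡ project₁) (≈.trans identityˡ (≈.sym identityʳ)))
                     !-unique₂
      ; isoʳ = project₁
      }
    ; associator = λ X Y Z → record
      { from = assoc⇒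
      ; to   = assoc⇐
      ; isoˡ = ≈.trans ⟨⟩∘ (unique
                 (≈.trans identityʳ (≈.sym (≈.trans ⟨⟩∘
                   (unique (≈.sym project₁)
                           (≈.sym (≈.trans (pullʳ project₂) project₁))))))
                 (≈.trans identityʳ (≈.sym (≈.trans (pullʳ project₂) project₂))))
      ; isoʳ = ≈.trans ⟨⟩∘ (unique
                 (≈.trans identityʳ (≈.sym (≈.trans (pullʳ project₁) project₁)))
                 (≈.trans identityʳ (≈.sym (≈.trans ⟨⟩∘
                   (unique (≈.sym (≈.trans (pullʳ project₁) project₂))
                           (≈.sym project₂))))))
      }
    ; unitorˡ-natural    = project₂
    ; unitorʳ-natural    = project₁
    ; associator-natural = ≈.trans ⟨⟩∘ (≈.sym (≈.trans ×₁∘⟨⟩ (⟨⟩-cong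
        (≈.sym (≈.trans (pullʳ project₁) (≈.trans (pullˡ project₁) assoc)))
        (≈.trans ×₁∘⟨⟩ (≈.sym (≈.trans ⟨⟩∘ (⟨⟩-cong
          (≈.trans (pullʳ project₁) (≈.trans (pullˡ project₂) assoc))
          project₂)))))))
    ; triangle = ≈.trans ×₁∘⟨⟩ (⟨⟩-cong identityˡ
                   (≈.trans project₂ (≈.sym identityˡ)))
    ; pentagon = pentagon′
    }
    where
    assoc⇒ : ∀ {X Y Z} → (X × Y) × Z ⇒ X × (Y × Z)
    assoc⇒ = ⟨ π₁ ∘ π₁ , ⟨ π₂ ∘ π₁ , π₂ ⟩ ⟩

    assoc⇐ : ∀ {X Y Z} → X × (Y × Z) ⇒ (X × Y) × Z
    assoc⇐ = ⟨ ⟨ π₁ , π₁ ∘ π₂ ⟩ , π₂ ∘ π₂ ⟩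

    assoc∘⟨⟩ : ∀ {V X Y Z} {f : V ⇒ X} {g : V ⇒ Y} {h : V ⇒ Z} →
               assoc⇒ ∘ ⟨ ⟨ f , g ⟩ , h ⟩ ≈ ⟨ f , ⟨ g , h ⟩ ⟩
    assoc∘⟨⟩ = ≈.trans ⟨⟩∘ (⟨⟩-cong
      (≈.trans (pullʳ project₁) project₁)
      (≈.trans ⟨⟩∘ (⟨⟩-cong (≈.trans (pullʳ project₁) project₂) project₂)))

    pentagon′ : ∀ {W X Y Z} → (id {W} ×₁ assoc⇒ {X} {Y} {Z}) ∘ (assoc⇒ ∘ (assoc⇒ ×₁ id))
                ≈ assoc⇒ ∘ assoc⇒
    pentagon′ = begin
      (id ×₁ assoc⇒) ∘ (assoc⇒ ∘ ⟨ assoc⇒ ∘ π₁ , id ∘ π₂ ⟩)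
        ≈⟨ ∘-resp-≈ʳ (∘-resp-≈ʳ (⟨⟩-cong (≈.trans ⟨⟩∘ (⟨⟩-cong assoc ⟨⟩∘)) identityˡ)) ⟩
      (id ×₁ assoc⇒) ∘ (assoc⇒ ∘ ⟨ ⟨ π₁ ∘ (π₁ ∘ π₁) , ⟨ (π₂ ∘ π₁) ∘ π₁ , π₂ ∘ π₁ ⟩ ⟩ , π₂ ⟩)
        ≈⟨ ∘-resp-≈ʳ assoc∘⟨⟩ ⟩
      (id ×₁ assoc⇒) ∘ ⟨ π₁ ∘ (π₁ ∘ π₁) , ⟨ ⟨ (π₂ ∘ π₁) ∘ π₁ , π₂ ∘ π₁ ⟩ , π₂ ⟩ ⟩
        ≈⟨ ×₁∘⟨⟩ ⟩
      ⟨ id ∘ (π₁ ∘ (π₁ ∘ π₁)) , assoc⇒ ∘ ⟨ ⟨ (π₂ ∘ π₁) ∘ π₁ , π₂ ∘ π₁ ⟩ , π₂ ⟩ ⟩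
        ≈⟨ ⟨⟩-cong identityˡ assoc∘⟨⟩ ⟩
      ⟨ π₁ ∘ (π₁ ∘ π₁) , ⟨ (π₂ ∘ π₁) ∘ π₁ , ⟨ π₂ ∘ π₁ , π₂ ⟩ ⟩ ⟩
        ≈⟨ ⟨⟩-cong ≈.refl (⟨⟩-cong assoc ≈.refl) ⟩
      ⟨ π₁ ∘ (π₁ ∘ π₁) , ⟨ π₂ ∘ (π₁ ∘ π₁) , ⟨ π₂ ∘ π₁ , π₂ ⟩ ⟩ ⟩
        ≈⟨ ⟨⟩-cong (pullʳ project₁)
             (≈.trans ⟨⟩∘ (⟨⟩-cong (pullʳ project₁) project₂)) ⟨
      ⟨ (π₁ ∘ π₁) ∘ assoc⇒ , ⟨ π₂ ∘ π₁ , π₂ ⟩ ∘ assoc⇒ ⟩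
        ≈⟨ ⟨⟩∘ ⟨
      assoc⇒ ∘ assoc⇒ ∎
      where open ≈-Reasoning

record Monad {o ℓ e : Level} (C : Category o ℓ e) : Set (o ⊔ ℓ ⊔ e) where
  open Category C
  field
    functor   : Functor C C
  open Functor functor public renaming (F₀ to T₀; F₁ to T₁; F-resp-≈ to T-resp-≈; F-id to T-id; F-∘ to T-∘)
  field
    η         : ∀ {X} → X ⇒ T₀ X
    μ         : ∀ {X} → T₀ (T₀ X) ⇒ T₀ X
    η-natural : ∀ {X Y} {f : X ⇒ Y} → η ∘ f ≈ T₁ f ∘ η
    μ-natural : ∀ {X Y} {f : X ⇒ Y} → μ ∘ T₁ (T₁ f) ≈ T₁ f ∘ μ
    μ-assoc   : ∀ {X} → μ {X} ∘ T₁ μ ≈ μ ∘ μ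
    μ-unitˡ   : ∀ {X} → μ {X} ∘ T₁ η ≈ id
    μ-unitʳ   : ∀ {X} → μ {X} ∘ η ≈ id

record Strength {o ℓ e : Level} {C : Category o ℓ e} (M : Monoidal C) (T : Monad C) :
                Set (o ⊔ ℓ ⊔ e) where
  open Category C
  open Monoidal M
  open Monad T
  field
    τ         : ∀ {X Y} → X ⊗₀ T₀ Y ⇒ T₀ (X ⊗₀ Y)
    τ-natural : ∀ {X X′ Y Y′} {f : X ⇒ X′} {g : Y ⇒ Y′} →
                τ ∘ (f ⊗₁ T₁ g) ≈ T₁ (f ⊗₁ g) ∘ τ
    τ-unitor  : ∀ {X} → T₁ (λ⇒ {X}) ∘ τ ≈ λ⇒
    τ-assoc   : ∀ {X Y Z} → T₁ (α⇒ {X} {Y} {Z}) ∘ τ ≈ τ ∘ ((id ⊗₁ τ) ∘ α⇒)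
    τ-η       : ∀ {X Y} → τ {X} {Y} ∘ (id ⊗₁ η) ≈ η
    τ-μ       : ∀ {X Y} → τ {X} {Y} ∘ (id ⊗₁ μ) ≈ μ ∘ (T₁ τ ∘ τ)

module DoubleStrength {o ℓ e : Level} {C : Category o ℓ e} (S : SymmetricMonoidal C) {T : Monad C}
                      (str : Strength (SymmetricMonoidal.monoidal S) T) where
  open Category C
  open SymmetricMonoidal S
  open Monad T
  open Strength str

  τ′ : ∀ {X Y} → T₀ X ⊗₀ Y ⇒ T₀ (X ⊗₀ Y)
  τ′ = T₁ braid ∘ (τ ∘ braid)

  -- The left component is evaluated first.
  dst : ∀ {X Y} → T₀ X ⊗₀ T₀ Y ⇒ T₀ (X ⊗₀ Y)
  dst = μ ∘ (T₁ τ ∘ τ′)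

  τ′-natural : ∀ {X X′ Y Y′} {f : X ⇒ X′} {g : Y ⇒ Y′} →
               τ′ ∘ (T₁ f ⊗₁ g) ≈ T₁ (f ⊗₁ g) ∘ τ′
  τ′-natural {f = f} {g} = begin
    (T₁ braid ∘ (τ ∘ braid)) ∘ (T₁ f ⊗₁ g)  ≈⟨ pullʳ (pullʳ braid-natural) ⟩
    T₁ braid ∘ (τ ∘ ((g ⊗₁ T₁ f) ∘ braid))  ≈⟨ ∘-resp-≈ʳ (pullˡ τ-natural) ⟩
    T₁ braid ∘ ((T₁ (g ⊗₁ f) ∘ τ) ∘ braid)  ≈⟨ ∘-resp-≈ʳ assoc ⟩
    T₁ braid ∘ (T₁ (g ⊗₁ f) ∘ (τ ∘ braid))  ≈⟨ pullˡ (≈.sym T-∘) ⟩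
    T₁ (braid ∘ (g ⊗₁ f)) ∘ (τ ∘ braid)     ≈⟨ ∘-resp-≈ˡ (T-resp-≈ braid-natural) ⟩
    T₁ ((f ⊗₁ g) ∘ braid) ∘ (τ ∘ braid)     ≈⟨ ∘-resp-≈ˡ T-∘ ⟩
    (T₁ (f ⊗₁ g) ∘ T₁ braid) ∘ (τ ∘ braid)  ≈⟨ assoc ⟩
    T₁ (f ⊗₁ g) ∘ τ′                        ∎
    where open ≈-Reasoning

  τ′-η : ∀ {X Y} → τ′ {X} {Y} ∘ (η ⊗₁ id) ≈ η
  τ′-η = begin
    (T₁ braid ∘ (τ ∘ braid)) ∘ (η ⊗₁ id)  ≈⟨ pullʳ (pullʳ braid-natural) ⟩
    T₁ braid ∘ (τ ∘ ((id ⊗₁ η) ∘ braid))  ≈⟨ ∘-resp-≈ʳ (pullˡ τ-η) ⟩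
    T₁ braid ∘ (η ∘ braid)                ≈⟨ pullˡ (≈.sym η-natural) ⟩
    (η ∘ braid) ∘ braid                   ≈⟨ pullʳ braid-braid ⟩
    η ∘ id                                ≈⟨ identityʳ ⟩
    η                                     ∎
    where open ≈-Reasoning

  dst-natural : ∀ {X X′ Y Y′} {f : X ⇒ X′} {g : Y ⇒ Y′} →
                dst ∘ (T₁ f ⊗₁ T₁ g) ≈ T₁ (f ⊗₁ g) ∘ dst
  dst-natural {f = f} {g} = begin
    (μ ∘ (T₁ τ ∘ τ′)) ∘ (T₁ f ⊗₁ T₁ g)         ≈⟨ pullʳ (pullʳ τ′-natural) ⟩
    μ ∘ (T₁ τ ∘ (T₁ (f ⊗₁ T₁ g) ∘ τ′))         ≈⟨ ∘-resp-≈ʳ (pullˡ (≈.sym T-∘)) ⟩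
    μ ∘ (T₁ (τ ∘ (f ⊗₁ T₁ g)) ∘ τ′)            ≈⟨ ∘-resp-≈ʳ (∘-resp-≈ˡ (T-resp-≈ τ-natural)) ⟩
    μ ∘ (T₁ (T₁ (f ⊗₁ g) ∘ τ) ∘ τ′)            ≈⟨ ∘-resp-≈ʳ (≈.trans (∘-resp-≈ˡ T-∘) assoc) ⟩
    μ ∘ (T₁ (T₁ (f ⊗₁ g)) ∘ (T₁ τ ∘ τ′))       ≈⟨ pullˡ μ-natural ⟩
    (T₁ (f ⊗₁ g) ∘ μ) ∘ (T₁ τ ∘ τ′)            ≈⟨ assoc ⟩
    T₁ (f ⊗₁ g) ∘ dst                          ∎
    where open ≈-Reasoning

  dst-η : ∀ {X Y} → dst {X} {Y} ∘ (η ⊗₁ η) ≈ η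
  dst-η = begin
    (μ ∘ (T₁ τ ∘ τ′)) ∘ (η ⊗₁ η)
      ≈⟨ ∘-resp-≈ʳ (≈.trans (⊗-resp-≈ (≈.sym identityʳ) (≈.sym identityˡ)) ⊗-∘) ⟩
    (μ ∘ (T₁ τ ∘ τ′)) ∘ ((η ⊗₁ id) ∘ (id ⊗₁ η))
      ≈⟨ pullʳ (pullʳ (pullˡ τ′-η)) ⟩
    μ ∘ (T₁ τ ∘ (η ∘ (id ⊗₁ η)))  ≈⟨ ∘-resp-≈ʳ (pullˡ (≈.sym η-natural)) ⟩
    μ ∘ ((η ∘ τ) ∘ (id ⊗₁ η))     ≈⟨ ∘-resp-≈ʳ (pullʳ τ-η) ⟩
    μ ∘ (η ∘ η)                   ≈⟨ pullˡ μ-unitʳ ⟩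
    id ∘ η                        ≈⟨ identityˡ ⟩
    η                             ∎
    where open ≈-Reasoning

module AdjunctionProperties {o ℓ e o′ ℓ′ e′ : Level} {𝒜 : Category o ℓ e} {ℬ : Category o′ ℓ′ e′}
         (L : Functor 𝒜 ℬ) (R : Functor ℬ 𝒜)
         (L⊣R : Adjunction (Functor.bare L) (Functor.bare R)) where
  private
    module B = Category ℬ
    module L = Functor L
    module R = Functor R
  open Category 𝒜
  open Adjunction L⊣R

  T₁ : ∀ {X Y} → X ⇒ Y → R.F₀ (L.F₀ X) ⇒ R.F₀ (L.F₀ Y)
  T₁ f = R.F₁ (L.F₁ f)

  _* : ∀ {X Y} → X ⇒ R.F₀ Y → R.F₀ (L.F₀ X) ⇒ R.F₀ Y
  g * = R.F₁ (♭ g)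

  ♭-unique : ∀ {X Y} {g : X ⇒ R.F₀ Y} {h : L.F₀ X B.⇒ Y} → g ≈ ♯ h → ♭ g B.≈ h
  ♭-unique p = B.≈.trans (♭-cong p) (♭♯ _)

  R∘η : ∀ {X Y} (h : L.F₀ X B.⇒ Y) → R.F₁ h ∘ η ≈ ♯ h
  R∘η h = ≈.trans (≈.sym (φ-naturalʳ h B.id)) (♯-cong B.identityʳ)

  *∘η : ∀ {X Y} {g : X ⇒ R.F₀ Y} → g * ∘ η ≈ g
  *∘η = ≈.trans (R∘η _) (♯♭ _)

  *∘η∘ : ∀ {X Y Z} {g : X ⇒ R.F₀ Y} {f : Z ⇒ X} → g * ∘ (η ∘ f) ≈ g ∘ f
  *∘η∘ = pullˡ *∘η

  *-cong : ∀ {X Y} {g g′ : X ⇒ R.F₀ Y} → g ≈ g′ → g * ≈ g′ *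
  *-cong p = R.F-resp-≈ (♭-cong p)

  ♭-∘ˡ : ∀ {X Y Z} (h : Y B.⇒ Z) (g : X ⇒ R.F₀ Y) → ♭ (R.F₁ h ∘ g) B.≈ h B.∘ ♭ g
  ♭-∘ˡ h g = ♭-unique (≈.sym (≈.trans (φ-naturalʳ h (♭ g)) (∘-resp-≈ʳ (♯♭ g))))

  ♭-∘ʳ : ∀ {X X′ Y} (g : X ⇒ R.F₀ Y) (f : X′ ⇒ X) → ♭ (g ∘ f) B.≈ ♭ g B.∘ L.F₁ f
  ♭-∘ʳ g f = ♭-unique (≈.sym (≈.trans (φ-naturalˡ (♭ g) f) (∘-resp-≈ˡ (♯♭ g))))

  *-∘ˡ : ∀ {X Y Z} {h : Y B.⇒ Z} {g : X ⇒ R.F₀ Y} → (R.F₁ h ∘ g) * ≈ R.F₁ h ∘ g *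
  *-∘ˡ = ≈.trans (R.F-resp-≈ (♭-∘ˡ _ _)) R.F-∘

  *-∘ʳ : ∀ {X X′ Y} {g : X ⇒ R.F₀ Y} {f : X′ ⇒ X} → (g ∘ f) * ≈ g * ∘ T₁ f
  *-∘ʳ = ≈.trans (R.F-resp-≈ (♭-∘ʳ _ _)) R.F-∘

  η* : ∀ {X} → η {X} * ≈ id
  η* = ≈.trans (R.F-resp-≈ (♭♯ B.id)) R.F-id

  η-natural : ∀ {X Y} {f : X ⇒ Y} → η ∘ f ≈ T₁ f ∘ η
  η-natural {f = f} = ≈.trans (≈.sym (φ-naturalˡ B.id f))
                      (≈.trans (♯-cong B.identityˡ) (≈.sym (R∘η (L.F₁ f))))

  adjunctionMonad : Monad 𝒜
  adjunctionMonad = record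
    { functor   = record
      { bare = record
        { F₀       = λ X → R.F₀ (L.F₀ X)
        ; F₁       = T₁
        ; F-resp-≈ = λ p → R.F-resp-≈ (L.F-resp-≈ p)
        ; F-id     = ≈.trans (R.F-resp-≈ L.F-id) R.F-id
        }
      ; F-∘  = ≈.trans (R.F-resp-≈ L.F-∘) R.F-∘
      }
    ; η         = η
    ; μ         = id *
    ; η-natural = η-natural
    ; μ-natural = ≈.trans (≈.sym *-∘ʳ)
                  (≈.trans (*-cong (≈.trans identityˡ (≈.sym identityʳ))) *-∘ˡ)
    ; μ-assoc   = ≈.trans (≈.sym *-∘ʳ)
                  (≈.trans (*-cong (≈.trans identityˡ (≈.sym identityʳ))) *-∘ˡ)
    ; μ-unitˡ   = ≈.trans (≈.sym *-∘ʳ) (≈.trans (*-cong identityˡ) η*)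
    ; μ-unitʳ   = *∘η
    }

open AdjunctionProperties public using (adjunctionMonad)

module _ {oA ℓA eA oB ℓB eB : Level} {𝒜 : Category oA ℓA eA} {ℬ : Category oB ℓB eB}
         (L : Functor 𝒜 ℬ) (R : Functor ℬ 𝒜)
         (L⊣R : Adjunction (Functor.bare L) (Functor.bare R)) where
  private
    module A = Category 𝒜
    module B = Category ℬ
    module L = Functor L
    module R = Functor R
    open Adjunction L⊣R
    open AdjunctionProperties L R L⊣R hiding (adjunctionMonad)

  DuplObj : Set (oA ⊔ oB)
  DuplObj = A.Obj ⊎ B.Obj

  _⁺ : DuplObj → A.Obj
  inj₁ X ⁺ = X
  inj₂ X ⁺ = R.F₀ X

  _⁻ : DuplObj → B.Obj
  inj₁ X ⁻ = L.F₀ X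
  inj₂ X ⁻ = X

  DuplHom : DuplObj → DuplObj → Set ℓA
  DuplHom X Y = X ⁺ A.⇒ R.F₀ (Y ⁻)

  dupl-id : ∀ X → DuplHom X X
  dupl-id (inj₁ X) = η
  dupl-id (inj₂ X) = A.id

  dupl-∘ : ∀ X Z Y → DuplHom Z Y → DuplHom X Z → DuplHom X Y
  dupl-∘ X (inj₁ Z) Y g f = R.F₁ (♭ g) A.∘ f
  dupl-∘ X (inj₂ Z) Y g f = g A.∘ f

  private
    dupl-identityˡ : ∀ X Y (f : DuplHom X Y) → dupl-∘ X Y Y (dupl-id Y) f A.≈ f
    dupl-identityˡ X (inj₁ Y) f = A.≈.trans (A.∘-resp-≈ˡ η*) A.identityˡ
    dupl-identityˡ X (inj₂ Y) f = A.identityˡ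

    dupl-identityʳ : ∀ X Y (f : DuplHom X Y) → dupl-∘ X X Y f (dupl-id X) A.≈ f
    dupl-identityʳ (inj₁ X) Y f = *∘η
    dupl-identityʳ (inj₂ X) Y f = A.identityʳ

    dupl-∘-resp : ∀ X Z Y {g g′ : DuplHom Z Y} {f f′ : DuplHom X Z} →
                  g A.≈ g′ → f A.≈ f′ → dupl-∘ X Z Y g f A.≈ dupl-∘ X Z Y g′ f′
    dupl-∘-resp X (inj₁ Z) Y p q = A.∘-resp-≈ (*-cong p) q
    dupl-∘-resp X (inj₂ Z) Y p q = A.∘-resp-≈ p q

  dupl : NonAssocCategory (oA ⊔ oB) ℓA eA
  dupl = record
    { Obj       = DuplObj
    ; _⇒_       = DuplHom
    ; _≈_       = A._≈_
    ; id        = λ {X} → dupl-id X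
    ; _∘_       = λ {X} {Z} {Y} → dupl-∘ X Z Y
    ; equiv     = A.equiv
    ; identityˡ = λ {X} {Y} {f} → dupl-identityˡ X Y f
    ; identityʳ = λ {X} {Y} {f} → dupl-identityʳ X Y f
    ; ∘-resp-≈  = λ {X} {Z} {Y} → dupl-∘-resp X Z Y
    }

  private
    module D = NonAssocCategory dupl

  inj₁-positive : ∀ X → D.Positive (inj₁ X)
  inj₁-positive X h {W = inj₁ W} f g =
    A.≈.trans (A.∘-resp-≈ˡ (*-∘ˡ {h = ♭ h} {g = g})) A.assoc
  inj₁-positive X h {W = inj₂ W} f g = A.assoc

  -- The morphism of the duploid given by a morphism of 𝒜 between the positive
  -- parts; for Y in 𝒜 it is η ∘ a.
  pure : ∀ X Y → X ⁺ A.⇒ Y ⁺ → DuplHom X Y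
  pure X Y a = dupl-id Y A.∘ a

  ∘-pure : ∀ X Z Y {g : DuplHom Z Y} {a : X ⁺ A.⇒ Z ⁺} →
           dupl-∘ X Z Y g (pure X Z a) A.≈ g A.∘ a
  ∘-pure X (inj₁ Z) Y = *∘η∘
  ∘-pure X (inj₂ Z) Y = A.∘-resp-≈ʳ A.identityˡ

  pure-∘ : ∀ X Z Y {b : Z ⁺ A.⇒ Y ⁺} {a : X ⁺ A.⇒ Z ⁺} →
           dupl-∘ X Z Y (pure Z Y b) (pure X Z a) A.≈ pure X Y (b A.∘ a)
  pure-∘ X Z Y = A.≈.trans (∘-pure X Z Y) A.assoc

  pure-id : ∀ X → pure X X A.id A.≈ dupl-id X
  pure-id X = A.identityʳ

  pure-cong : ∀ X Y {a b : X ⁺ A.⇒ Y ⁺} → a A.≈ b → pure X Y a A.≈ pure X Y b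
  pure-cong X Y p = A.∘-resp-≈ʳ p

  pure-thunkable : ∀ X Y (a : X ⁺ A.⇒ Y ⁺) → D.Thunkable {X} {Y} (pure X Y a)
  pure-thunkable X Y a {Z} {W} g h = begin
    dupl-∘ X Y W (dupl-∘ Y Z W h g) (pure X Y a)  ≈⟨ ∘-pure X Y W ⟩
    dupl-∘ Y Z W h g A.∘ a                        ≈⟨ shift Z g h ⟩
    dupl-∘ X Z W h (g A.∘ a)                      ≈⟨ D.∘-resp-≈ {X} {Z} {W} A.≈.refl (∘-pure X Y Z) ⟨
    dupl-∘ X Z W h (dupl-∘ X Y Z g (pure X Y a))  ∎
    where
    open A.≈-Reasoning
    shift : ∀ Z (g : DuplHom Y Z) (h : DuplHom Z W) →
            dupl-∘ Y Z W h g A.∘ a A.≈ dupl-∘ X Z W h (g A.∘ a)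
    shift (inj₁ Z) g h = A.assoc
    shift (inj₂ Z) g h = A.assoc

  _° : ∀ {X Y} → DuplHom X Y → X ⁺ A.⇒ R.F₀ (L.F₀ (Y ⁺))
  _° {X} {inj₁ Y} f = f
  _° {X} {inj₂ Y} f = η A.∘ f

  °-cong : ∀ X Y {f g : DuplHom X Y} → f A.≈ g → _° {X} {Y} f A.≈ _° {X} {Y} g
  °-cong X (inj₁ Y) p = p
  °-cong X (inj₂ Y) p = A.∘-resp-≈ʳ p

  °-pure : ∀ X Y {a : X ⁺ A.⇒ Y ⁺} → _° {X} {Y} (pure X Y a) A.≈ η A.∘ a
  °-pure X (inj₁ Y) = A.≈.refl
  °-pure X (inj₂ Y) = A.∘-resp-≈ʳ A.identityˡ

  °-id : ∀ X → _° {X} {X} (dupl-id X) A.≈ η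
  °-id (inj₁ X) = A.≈.refl
  °-id (inj₂ X) = A.identityʳ

  °-∘ : ∀ X Z Y {g : DuplHom Z Y} {f : DuplHom X Z} → D.Thunkable {X} {Z} f →
        _° {X} {Y} (dupl-∘ X Z Y g f) A.≈ (_° {Z} {Y} g) * A.∘ (_° {X} {Z} f)
  °-∘ X (inj₁ Z) (inj₁ Y) f-th = A.≈.refl
  °-∘ X (inj₁ Z) (inj₂ Y) {g} f-th = A.≈.sym (f-th {inj₂ Y} {inj₁ (R.F₀ Y)} g η)
  °-∘ X (inj₂ Z) (inj₁ Y) f-th = A.≈.sym *∘η∘
  °-∘ X (inj₂ Z) (inj₂ Y) f-th = A.≈.trans A.sym-assoc (A.≈.sym *∘η∘)

  unwrap-° : ∀ X Y {f : DuplHom X Y} → dupl-id Y * A.∘ (_° {X} {Y} f) A.≈ f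
  unwrap-° X (inj₁ Y) = A.≈.trans (A.∘-resp-≈ˡ η*) A.identityˡ
  unwrap-° X (inj₂ Y) = A.≈.trans *∘η∘ A.identityˡ

  -- Thunkability in the duploid is the usual equation on Kleisli morphisms.
  thunkable⇒ : ∀ X Y {f : DuplHom X Y} → D.Thunkable {X} {Y} f →
               T₁ η A.∘ (_° {X} {Y} f) A.≈ η A.∘ (_° {X} {Y} f)
  thunkable⇒ X (inj₁ Y) {f} f-th = begin
    T₁ η A.∘ f                  ≈⟨ A.∘-resp-≈ˡ (A.≈.trans (A.≈.sym A.identityˡ) (A.∘-resp-≈ˡ (A.≈.sym η*))) ⟩
    (η * A.∘ T₁ η) A.∘ f        ≈⟨ A.∘-resp-≈ˡ *-∘ʳ ⟨
    (η A.∘ η) * A.∘ f           ≈⟨ f-th {inj₂ (L.F₀ Y)} {inj₁ (R.F₀ (L.F₀ Y))} η η ⟩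
    η A.∘ (η * A.∘ f)           ≈⟨ A.∘-resp-≈ʳ (A.≈.trans (A.∘-resp-≈ˡ η*) A.identityˡ) ⟩
    η A.∘ f                     ∎
    where open A.≈-Reasoning
  thunkable⇒ X (inj₂ Y) f-th = A.≈.trans (A.pullˡ (A.≈.sym η-natural)) A.assoc

  thunkable⇐ : ∀ X Y {f : DuplHom X (inj₁ Y)} → T₁ η A.∘ f A.≈ η A.∘ f →
               D.Thunkable {X} {inj₁ Y} f
  thunkable⇐ X Y {f} p {inj₁ Z} g h = A.≈.trans (A.∘-resp-≈ˡ *-∘ˡ) A.assoc
  thunkable⇐ X Y {f} p {inj₂ Z} g h = begin
    (h A.∘ g) * A.∘ f                ≈⟨ A.∘-resp-≈ˡ (*-cong (A.∘-resp-≈ A.≈.refl *∘η)) ⟨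
    (h A.∘ (g * A.∘ η)) * A.∘ f      ≈⟨ A.∘-resp-≈ˡ (*-cong A.sym-assoc) ⟩
    ((h A.∘ g *) A.∘ η) * A.∘ f      ≈⟨ A.∘-resp-≈ˡ *-∘ʳ ⟩
    ((h A.∘ g *) * A.∘ T₁ η) A.∘ f   ≈⟨ A.pullʳ p ⟩
    (h A.∘ g *) * A.∘ (η A.∘ f)      ≈⟨ *∘η∘ ⟩
    (h A.∘ g *) A.∘ f                ≈⟨ A.assoc ⟩
    h A.∘ (g * A.∘ f)                ∎
    where open A.≈-Reasoning

  module _ (S : SymmetricMonoidal 𝒜)
           (str : Strength (SymmetricMonoidal.monoidal S) (adjunctionMonad L R L⊣R)) where
    private
      module S = SymmetricMonoidal S
      open S using (_⊗₀_; _⊗₁_)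
      open DoubleStrength S str using (dst; dst-natural; dst-η)
      module P = Category (𝒫ₜ dupl)
      open PositiveObj
      open ThunkableHom

    dupl-⊗₀ : DuplObj → DuplObj → DuplObj
    dupl-⊗₀ X Y = inj₁ (X ⁺ ⊗₀ Y ⁺)

    dupl-⊗₁ : ∀ X X′ Y Y′ → DuplHom X X′ → DuplHom Y Y′ →
              DuplHom (dupl-⊗₀ X Y) (dupl-⊗₀ X′ Y′)
    dupl-⊗₁ X X′ Y Y′ f g = dst A.∘ ((_° {X} {X′} f) ⊗₁ (_° {Y} {Y′} g))

    private
      split : ∀ {X X′ X″ Y Y′ Y″}
              {f : X A.⇒ X′} {f′ : X′ A.⇒ X″} {g : Y A.⇒ Y′} {g′ : Y′ A.⇒ Y″} →
              (f′ ⊗₁ g′) A.∘ (f ⊗₁ g) A.≈ (f′ A.∘ f) ⊗₁ (g′ A.∘ g)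
      split = A.≈.sym S.⊗-∘

      -- Kleisli morphisms satisfying the thunkability equation.
      Value : ∀ {X Y} → X A.⇒ R.F₀ (L.F₀ Y) → Set eA
      Value f = T₁ η A.∘ f A.≈ η A.∘ f

      T-⊗-dst : ∀ {X X′ X″ Y Y′ Y″} {f : X A.⇒ R.F₀ (L.F₀ X′)} {g : Y A.⇒ R.F₀ (L.F₀ Y′)}
                {a : X′ A.⇒ X″} {b : Y′ A.⇒ Y″} {f′ : X A.⇒ X″} {g′ : Y A.⇒ Y″} →
                T₁ a A.∘ f A.≈ η A.∘ f′ → T₁ b A.∘ g A.≈ η A.∘ g′ →
                T₁ (a ⊗₁ b) A.∘ (dst A.∘ (f ⊗₁ g)) A.≈ η A.∘ (f′ ⊗₁ g′)
      T-⊗-dst {f = f} {g} {a} {b} {f′} {g′} p q = begin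
        T₁ (a ⊗₁ b) A.∘ (dst A.∘ (f ⊗₁ g))    ≈⟨ A.pullˡ (A.≈.sym dst-natural) ⟩
        (dst A.∘ (T₁ a ⊗₁ T₁ b)) A.∘ (f ⊗₁ g) ≈⟨ A.pullʳ split ⟩
        dst A.∘ ((T₁ a A.∘ f) ⊗₁ (T₁ b A.∘ g)) ≈⟨ A.∘-resp-≈ʳ (S.⊗-resp-≈ p q) ⟩
        dst A.∘ ((η A.∘ f′) ⊗₁ (η A.∘ g′))    ≈⟨ A.∘-resp-≈ʳ S.⊗-∘ ⟩
        dst A.∘ ((η ⊗₁ η) A.∘ (f′ ⊗₁ g′))     ≈⟨ A.pullˡ dst-η ⟩
        η A.∘ (f′ ⊗₁ g′)                      ∎
        where open A.≈-Reasoning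

      T-id∘η : ∀ {X Y} {f : X A.⇒ Y} → T₁ A.id A.∘ (η A.∘ f) A.≈ η A.∘ f
      T-id∘η = A.≈.trans (A.∘-resp-≈ˡ (A.≈.trans (R.F-resp-≈ L.F-id) R.F-id)) A.identityˡ

      T-id∘η′ : ∀ {X} → T₁ A.id A.∘ η {X} A.≈ η A.∘ A.id
      T-id∘η′ = A.≈.trans (A.∘-resp-≈ˡ (A.≈.trans (R.F-resp-≈ L.F-id) R.F-id))
                (A.≈.trans A.identityˡ (A.≈.sym A.identityʳ))

      -- If a maps f to a value f′, then Kleisli-composing with p ∘ a amounts
      -- to composing p with f′.
      *-value : ∀ {X Y Z W} {f : X A.⇒ R.F₀ (L.F₀ Y)} {a : Y A.⇒ Z} {f′ : X A.⇒ Z}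
                {k : Y A.⇒ R.F₀ W} (p : Z A.⇒ R.F₀ W) →
                T₁ a A.∘ f A.≈ η A.∘ f′ → p A.∘ a A.≈ k → k * A.∘ f A.≈ p A.∘ f′
      *-value {f = f} {a} {f′} {k} p q r = begin
        k * A.∘ f              ≈⟨ A.∘-resp-≈ˡ (*-cong r) ⟨
        (p A.∘ a) * A.∘ f      ≈⟨ A.∘-resp-≈ˡ *-∘ʳ ⟩
        (p * A.∘ T₁ a) A.∘ f   ≈⟨ A.pullʳ q ⟩
        p * A.∘ (η A.∘ f′)     ≈⟨ *∘η∘ ⟩
        p A.∘ f′               ∎
        where open A.≈-Reasoning

      value : ∀ {X Y} (f : X P.⇒ Y) → Value (_° {obj X} {obj Y} (hom f))
      value {X} {Y} f =
        thunkable⇒ (obj X) (obj Y) (λ {Z} {W} → thunkable f {Z} {W})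

      dst-value : ∀ {X X′ Y Y′} {f : X A.⇒ R.F₀ (L.F₀ X′)} {g : Y A.⇒ R.F₀ (L.F₀ Y′)} →
                  Value f → Value g → Value (dst A.∘ (f ⊗₁ g))
      dst-value {f = f} {g} p q = begin
        T₁ η A.∘ (dst A.∘ (f ⊗₁ g))
          ≈⟨ A.∘-resp-≈ˡ (R.F-resp-≈ (L.F-resp-≈ dst-η)) ⟨
        T₁ (dst A.∘ (η ⊗₁ η)) A.∘ (dst A.∘ (f ⊗₁ g))
          ≈⟨ A.∘-resp-≈ˡ (A.≈.trans (R.F-resp-≈ L.F-∘) R.F-∘) ⟩
        (T₁ dst A.∘ T₁ (η ⊗₁ η)) A.∘ (dst A.∘ (f ⊗₁ g))
          ≈⟨ A.pullʳ (T-⊗-dst p q) ⟩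
        T₁ dst A.∘ (η A.∘ (f ⊗₁ g))
          ≈⟨ A.pullˡ (A.≈.sym η-natural) ⟩
        (η A.∘ dst) A.∘ (f ⊗₁ g)
          ≈⟨ A.assoc ⟩
        η A.∘ (dst A.∘ (f ⊗₁ g)) ∎
        where open A.≈-Reasoning

    infixr 10 _⊗ₚ_ _⊗ₜ_

    _⊗ₚ_ : PositiveObj dupl → PositiveObj dupl → PositiveObj dupl
    X ⊗ₚ Y = dupl-⊗₀ (obj X) (obj Y) ,⁺ inj₁-positive (obj X ⁺ ⊗₀ obj Y ⁺)

    _⊗ₜ_ : ∀ {X X′ Y Y′} → ThunkableHom dupl X X′ → ThunkableHom dupl Y Y′ →
           ThunkableHom dupl (X ⊗ₚ Y) (X′ ⊗ₚ Y′)
    _⊗ₜ_ {X} {X′} {Y} {Y′} f g =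
      dupl-⊗₁ (obj X) (obj X′) (obj Y) (obj Y′) (hom f) (hom g) ,ᵗ
      λ {Z} {W} → thunkable⇐ (obj (X ⊗ₚ Y)) (obj X′ ⁺ ⊗₀ obj Y′ ⁺)
                    (dst-value (value f) (value g)) {Z} {W}

    pureₜ : ∀ {X Y} → obj X ⁺ A.⇒ obj Y ⁺ → ThunkableHom dupl X Y
    pureₜ {X} {Y} a = pure (obj X) (obj Y) a ,ᵗ
      λ {Z} {W} → pure-thunkable (obj X) (obj Y) a {Z} {W}

    pureₜ-⊗ : ∀ {X X′ Y Y′} {a : obj X ⁺ A.⇒ obj X′ ⁺} {b : obj Y ⁺ A.⇒ obj Y′ ⁺} →
              pureₜ {X} {X′} a ⊗ₜ pureₜ {Y} {Y′} b P.≈ pureₜ {X ⊗ₚ Y} {X′ ⊗ₚ Y′} (a ⊗₁ b)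
    pureₜ-⊗ {X} {X′} {Y} {Y′} {a} {b} = begin
      dst A.∘ (_° {obj X} {obj X′} _ ⊗₁ _° {obj Y} {obj Y′} _)
        ≈⟨ A.∘-resp-≈ʳ (S.⊗-resp-≈ (°-pure (obj X) (obj X′)) (°-pure (obj Y) (obj Y′))) ⟩
      dst A.∘ ((η A.∘ a) ⊗₁ (η A.∘ b))   ≈⟨ A.∘-resp-≈ʳ S.⊗-∘ ⟩
      dst A.∘ ((η ⊗₁ η) A.∘ (a ⊗₁ b))    ≈⟨ A.pullˡ dst-η ⟩
      η A.∘ (a ⊗₁ b)                     ∎
      where open A.≈-Reasoning

    °-∘ₜ : ∀ {X Z Y} (g : Z P.⇒ Y) (f : X P.⇒ Z) →
           _° {obj X} {obj Y} (hom (g P.∘ f)) A.≈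
           (_° {obj Z} {obj Y} (hom g)) * A.∘ (_° {obj X} {obj Z} (hom f))
    °-∘ₜ {X} {Z} {Y} g f =
      °-∘ (obj X) (obj Z) (obj Y) (λ {V} {W} → thunkable f {V} {W})

    pureₜ-∘ : ∀ {X Z Y} {b : obj Z ⁺ A.⇒ obj Y ⁺} {a : obj X ⁺ A.⇒ obj Z ⁺} →
              pureₜ {Z} {Y} b P.∘ pureₜ {X} {Z} a P.≈ pureₜ {X} {Y} (b A.∘ a)
    pureₜ-∘ {X} {Z} {Y} = pure-∘ (obj X) (obj Z) (obj Y)

    pureₜ-cong : ∀ {X Y} {a b : obj X ⁺ A.⇒ obj Y ⁺} → a A.≈ b →
                 pureₜ {X} {Y} a P.≈ pureₜ {X} {Y} b
    pureₜ-cong {X} {Y} = pure-cong (obj X) (obj Y)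

    pureₜ-id : ∀ {X} → pureₜ {X} {X} A.id P.≈ P.id
    pureₜ-id {X} = pure-id (obj X)

    ∘-pureₜ : ∀ {X Z Y} (g : Z P.⇒ Y) {a : obj X ⁺ A.⇒ obj Z ⁺} →
              hom (g P.∘ pureₜ {X} {Z} a) A.≈ hom g A.∘ a
    ∘-pureₜ {X} {Z} {Y} g = ∘-pure (obj X) (obj Z) (obj Y)

    pureₜ-iso : ∀ {X Y} → obj X ⁺ A.≅ obj Y ⁺ → X P.≅ Y
    pureₜ-iso {X} {Y} i = record
      { from = pureₜ {X} {Y} from
      ; to   = pureₜ {Y} {X} to
      ; isoˡ = A.≈.trans (pureₜ-∘ {X} {Y} {X})
                 (A.≈.trans (pureₜ-cong {X} {X} isoˡ) (pureₜ-id {X}))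
      ; isoʳ = A.≈.trans (pureₜ-∘ {Y} {X} {Y})
                 (A.≈.trans (pureₜ-cong {Y} {Y} isoʳ) (pureₜ-id {Y}))
      }
      where open A._≅_ i

    id⊗pureₜ : ∀ {X Y Y′} {b : obj Y ⁺ A.⇒ obj Y′ ⁺} →
               P.id {X} ⊗ₜ pureₜ {Y} {Y′} b P.≈ pureₜ {X ⊗ₚ Y} {X ⊗ₚ Y′} (A.id ⊗₁ b)
    id⊗pureₜ {X} {Y} {Y′} = A.≈.trans
      (A.∘-resp-≈ʳ (S.⊗-resp-≈ (°-cong (obj X) (obj X) (A.≈.sym (pureₜ-id {X}))) A.≈.refl))
      (pureₜ-⊗ {X} {X} {Y} {Y′})

    pureₜ⊗id : ∀ {X X′ Y} {a : obj X ⁺ A.⇒ obj X′ ⁺} →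
               pureₜ {X} {X′} a ⊗ₜ P.id {Y} P.≈ pureₜ {X ⊗ₚ Y} {X′ ⊗ₚ Y} (a ⊗₁ A.id)
    pureₜ⊗id {X} {X′} {Y} = A.≈.trans
      (A.∘-resp-≈ʳ (S.⊗-resp-≈ A.≈.refl (°-cong (obj Y) (obj Y) (A.≈.sym (pureₜ-id {Y})))))
      (pureₜ-⊗ {X} {X′} {Y} {Y})

    unitₚ : PositiveObj dupl
    unitₚ = inj₁ S.unit ,⁺ inj₁-positive S.unit

    ⊗ₜ-resp-≈ : ∀ {X X′ Y Y′} {f f′ : X P.⇒ X′} {g g′ : Y P.⇒ Y′} →
                f P.≈ f′ → g P.≈ g′ → f ⊗ₜ g P.≈ f′ ⊗ₜ g′
    ⊗ₜ-resp-≈ {X} {X′} {Y} {Y′} p q = A.∘-resp-≈ʳ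
      (S.⊗-resp-≈ (°-cong (obj X) (obj X′) p) (°-cong (obj Y) (obj Y′) q))

    ⊗ₜ-id : ∀ {X Y} → P.id {X} ⊗ₜ P.id {Y} P.≈ P.id
    ⊗ₜ-id {X} {Y} = A.≈.trans
      (A.∘-resp-≈ʳ (S.⊗-resp-≈ (°-id (obj X)) (°-id (obj Y)))) dst-η

    ⊗ₜ-∘ : ∀ {X X′ X″ Y Y′ Y″}
           {f : X P.⇒ X′} {f′ : X′ P.⇒ X″} {g : Y P.⇒ Y′} {g′ : Y′ P.⇒ Y″} →
           (f′ P.∘ f) ⊗ₜ (g′ P.∘ g) P.≈ (f′ ⊗ₜ g′) P.∘ (f ⊗ₜ g)
    ⊗ₜ-∘ {X} {X′} {X″} {Y} {Y′} {Y″} {f} {f′} {g} {g′} = A.≈.trans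
      (A.∘-resp-≈ʳ (A.≈.trans (S.⊗-resp-≈ (°-∘ₜ f′ f) (°-∘ₜ g′ g)) S.⊗-∘))
      (A.≈.trans A.sym-assoc (A.≈.sym
        (*-value (dst A.∘ ((f′° *) ⊗₁ (g′° *)))
          (T-⊗-dst (value f) (value g))
          (A.pullʳ (A.≈.trans split (S.⊗-resp-≈ *∘η *∘η))))))
      where
      f′° = _° {obj X′} {obj X″} (hom f′)
      g′° = _° {obj Y′} {obj Y″} (hom g′)

    unitorˡₜ-natural : ∀ {X Y} {f : X P.⇒ Y} →
      pureₜ {unitₚ ⊗ₚ Y} {Y} S.λ⇒ P.∘ (P.id {unitₚ} ⊗ₜ f) P.≈
      f P.∘ pureₜ {unitₚ ⊗ₚ X} {X} S.λ⇒
    unitorˡₜ-natural {X} {Y} {f} = begin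
      (dupl-id (obj Y) A.∘ S.λ⇒) * A.∘ (dst A.∘ (η ⊗₁ f°))
        ≈⟨ *-value (dupl-id (obj Y) * A.∘ S.λ⇒) (T-⊗-dst T-id∘η′ (value f))
             (A.≈.trans (A.pullʳ S.unitorˡ-natural) *∘η∘) ⟩
      (dupl-id (obj Y) * A.∘ S.λ⇒) A.∘ (A.id ⊗₁ f°)
        ≈⟨ A.pullʳ S.unitorˡ-natural ⟩
      dupl-id (obj Y) * A.∘ (f° A.∘ S.λ⇒)
        ≈⟨ A.pullˡ (unwrap-° (obj X) (obj Y)) ⟩
      hom f A.∘ S.λ⇒
        ≈⟨ ∘-pureₜ {unitₚ ⊗ₚ X} {X} {Y} f ⟨
      hom (f P.∘ pureₜ {unitₚ ⊗ₚ X} {X} S.λ⇒) ∎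
      where
      open A.≈-Reasoning
      f° = _° {obj X} {obj Y} (hom f)

    unitorʳₜ-natural : ∀ {X Y} {f : X P.⇒ Y} →
      pureₜ {Y ⊗ₚ unitₚ} {Y} S.ρ⇒ P.∘ (f ⊗ₜ P.id {unitₚ}) P.≈
      f P.∘ pureₜ {X ⊗ₚ unitₚ} {X} S.ρ⇒
    unitorʳₜ-natural {X} {Y} {f} = begin
      (dupl-id (obj Y) A.∘ S.ρ⇒) * A.∘ (dst A.∘ (f° ⊗₁ η))
        ≈⟨ *-value (dupl-id (obj Y) * A.∘ S.ρ⇒) (T-⊗-dst (value f) T-id∘η′)
             (A.≈.trans (A.pullʳ S.unitorʳ-natural) *∘η∘) ⟩
      (dupl-id (obj Y) * A.∘ S.ρ⇒) A.∘ (f° ⊗₁ A.id)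
        ≈⟨ A.pullʳ S.unitorʳ-natural ⟩
      dupl-id (obj Y) * A.∘ (f° A.∘ S.ρ⇒)
        ≈⟨ A.pullˡ (unwrap-° (obj X) (obj Y)) ⟩
      hom f A.∘ S.ρ⇒
        ≈⟨ ∘-pureₜ {X ⊗ₚ unitₚ} {X} {Y} f ⟨
      hom (f P.∘ pureₜ {X ⊗ₚ unitₚ} {X} S.ρ⇒) ∎
      where
      open A.≈-Reasoning
      f° = _° {obj X} {obj Y} (hom f)

    αₜ : ∀ X Y Z → ((X ⊗ₚ Y) ⊗ₚ Z) P.⇒ (X ⊗ₚ (Y ⊗ₚ Z))
    αₜ X Y Z = pureₜ {(X ⊗ₚ Y) ⊗ₚ Z} {X ⊗ₚ (Y ⊗ₚ Z)} S.α⇒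

    αₜ-natural : ∀ {X X′ Y Y′ Z Z′} {f : X P.⇒ X′} {g : Y P.⇒ Y′} {h : Z P.⇒ Z′} →
                 αₜ X′ Y′ Z′ P.∘ ((f ⊗ₜ g) ⊗ₜ h) P.≈ (f ⊗ₜ (g ⊗ₜ h)) P.∘ αₜ X Y Z
    αₜ-natural {X} {X′} {Y} {Y′} {Z} {Z′} {f} {g} {h} = begin
      (η A.∘ S.α⇒) * A.∘ (dst A.∘ ((dst A.∘ (f° ⊗₁ g°)) ⊗₁ h°))
        ≈⟨ *-value (dst A.∘ ((A.id ⊗₁ dst) A.∘ S.α⇒))
             (T-⊗-dst (T-⊗-dst (value f) (value g)) (value h))
             k∘η ⟩
      (dst A.∘ ((A.id ⊗₁ dst) A.∘ S.α⇒)) A.∘ ((f° ⊗₁ g°) ⊗₁ h°)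
        ≈⟨ A.pullʳ (A.pullʳ S.associator-natural) ⟩
      dst A.∘ ((A.id ⊗₁ dst) A.∘ ((f° ⊗₁ (g° ⊗₁ h°)) A.∘ S.α⇒))
        ≈⟨ A.∘-resp-≈ʳ (A.pullˡ (A.≈.trans split (S.⊗-resp-≈ A.identityˡ A.≈.refl))) ⟩
      dst A.∘ ((f° ⊗₁ (dst A.∘ (g° ⊗₁ h°))) A.∘ S.α⇒)
        ≈⟨ A.sym-assoc ⟩
      hom (f ⊗ₜ (g ⊗ₜ h)) A.∘ S.α⇒
        ≈⟨ ∘-pureₜ {(X ⊗ₚ Y) ⊗ₚ Z} {X ⊗ₚ (Y ⊗ₚ Z)} {X′ ⊗ₚ (Y′ ⊗ₚ Z′)} (f ⊗ₜ (g ⊗ₜ h)) ⟨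
      hom ((f ⊗ₜ (g ⊗ₜ h)) P.∘ αₜ X Y Z) ∎
      where
      open A.≈-Reasoning
      f° = _° {obj X} {obj X′} (hom f)
      g° = _° {obj Y} {obj Y′} (hom g)
      h° = _° {obj Z} {obj Z′} (hom h)
      k∘η : ∀ {X Y Z} → (dst A.∘ ((A.id ⊗₁ dst) A.∘ S.α⇒)) A.∘ ((η {X} ⊗₁ η {Y}) ⊗₁ η {Z})
            A.≈ η A.∘ S.α⇒
      k∘η = begin
        (dst A.∘ ((A.id ⊗₁ dst) A.∘ S.α⇒)) A.∘ ((η ⊗₁ η) ⊗₁ η)
          ≈⟨ A.pullʳ (A.pullʳ S.associator-natural) ⟩
        dst A.∘ ((A.id ⊗₁ dst) A.∘ ((η ⊗₁ (η ⊗₁ η)) A.∘ S.α⇒))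
          ≈⟨ A.∘-resp-≈ʳ (A.pullˡ (A.≈.trans split (S.⊗-resp-≈ A.identityˡ dst-η))) ⟩
        dst A.∘ ((η ⊗₁ η) A.∘ S.α⇒)
          ≈⟨ A.pullˡ dst-η ⟩
        η A.∘ S.α⇒ ∎

    braidₜ : ∀ X Y → (X ⊗ₚ Y) P.⇒ (Y ⊗ₚ X)
    braidₜ X Y = pureₜ {X ⊗ₚ Y} {Y ⊗ₚ X} S.braid

    braidₜ-natural : ∀ {X X′ Y Y′} {f : X P.⇒ X′} {g : Y P.⇒ Y′} →
                     braidₜ X′ Y′ P.∘ (f ⊗ₜ g) P.≈ (g ⊗ₜ f) P.∘ braidₜ X Y
    braidₜ-natural {X} {X′} {Y} {Y′} {f} {g} = begin
      (η A.∘ S.braid) * A.∘ (dst A.∘ (f° ⊗₁ g°))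
        ≈⟨ *-value (dst A.∘ S.braid) (T-⊗-dst (value f) (value g))
             (A.≈.trans (A.pullʳ S.braid-natural) (A.pullˡ dst-η)) ⟩
      (dst A.∘ S.braid) A.∘ (f° ⊗₁ g°)  ≈⟨ A.pullʳ S.braid-natural ⟩
      dst A.∘ ((g° ⊗₁ f°) A.∘ S.braid)  ≈⟨ A.sym-assoc ⟩
      hom (g ⊗ₜ f) A.∘ S.braid
        ≈⟨ ∘-pureₜ {X ⊗ₚ Y} {Y ⊗ₚ X} {Y′ ⊗ₚ X′} (g ⊗ₜ f) ⟨
      hom ((g ⊗ₜ f) P.∘ braidₜ X Y) ∎
      where
      open A.≈-Reasoning
      f° = _° {obj X} {obj X′} (hom f)
      g° = _° {obj Y} {obj Y′} (hom g)

    -- The structural isomorphisms are those of 𝒜, made into morphisms of the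
    -- duploid by pure.  This also covers positive objects lying in ℬ.
    𝒫ₜ-symmetricMonoidal : SymmetricMonoidal (𝒫ₜ dupl)
    𝒫ₜ-symmetricMonoidal = record
      { monoidal = record
        { unit               = unitₚ
        ; _⊗₀_               = _⊗ₚ_
        ; _⊗₁_               = _⊗ₜ_
        ; ⊗-resp-≈           = λ {_} {_} {_} {_} {f} {f′} {g} {g′} →
                                 ⊗ₜ-resp-≈ {f = f} {f′} {g} {g′}
        ; ⊗-id               = λ {X} {Y} → ⊗ₜ-id {X} {Y}
        ; ⊗-∘                = λ {_} {_} {_} {_} {_} {_} {f} {f′} {g} {g′} →
                                 ⊗ₜ-∘ {f = f} {f′} {g} {g′}
        ; unitorˡ            = λ X → pureₜ-iso {unitₚ ⊗ₚ X} {X} (S.unitorˡ (obj X ⁺))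
        ; unitorʳ            = λ X → pureₜ-iso {X ⊗ₚ unitₚ} {X} (S.unitorʳ (obj X ⁺))
        ; associator         = λ X Y Z → pureₜ-iso {(X ⊗ₚ Y) ⊗ₚ Z} {X ⊗ₚ (Y ⊗ₚ Z)}
                                 (S.associator (obj X ⁺) (obj Y ⁺) (obj Z ⁺))
        ; unitorˡ-natural    = λ {_} {_} {f} → unitorˡₜ-natural {f = f}
        ; unitorʳ-natural    = λ {_} {_} {f} → unitorʳₜ-natural {f = f}
        ; associator-natural = λ {_} {_} {_} {_} {_} {_} {f} {g} {h} →
                                 αₜ-natural {f = f} {g} {h}
        ; triangle           = λ {X} {Y} → triangleₜ X Y
        ; pentagon           = λ {W} {X} {Y} {Z} → pentagonₜ W X Y Z
        }
      ; braid         = λ {X} {Y} → braidₜ X Y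
      ; braid-natural = λ {_} {_} {_} {_} {f} {g} → braidₜ-natural {f = f} {g}
      ; braid-braid   = λ {X} {Y} → braidₜ-braidₜ X Y
      ; hexagon       = λ {X} {Y} {Z} → hexagonₜ X Y Z
      }
      where
      open P.≈-Reasoning

      triangleₜ : ∀ X Y → (P.id {X} ⊗ₜ pureₜ {unitₚ ⊗ₚ Y} {Y} S.λ⇒) P.∘ αₜ X unitₚ Y P.≈
                  pureₜ {X ⊗ₚ unitₚ} {X} S.ρ⇒ ⊗ₜ P.id {Y}
      triangleₜ X Y = begin
        (P.id {X} ⊗ₜ pureₜ {unitₚ ⊗ₚ Y} {Y} S.λ⇒) P.∘ αₜ X unitₚ Y
          ≈⟨ P.∘-resp-≈ˡ {g = P.id {X} ⊗ₜ pureₜ {unitₚ ⊗ₚ Y} {Y} S.λ⇒}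
               {g′ = pureₜ {X ⊗ₚ (unitₚ ⊗ₚ Y)} {X ⊗ₚ Y} (A.id ⊗₁ S.λ⇒)}
               {f = αₜ X unitₚ Y} (id⊗pureₜ {X} {unitₚ ⊗ₚ Y} {Y}) ⟩
        pureₜ {X ⊗ₚ (unitₚ ⊗ₚ Y)} {X ⊗ₚ Y} (A.id ⊗₁ S.λ⇒) P.∘ αₜ X unitₚ Y
          ≈⟨ pureₜ-∘ {(X ⊗ₚ unitₚ) ⊗ₚ Y} {X ⊗ₚ (unitₚ ⊗ₚ Y)} {X ⊗ₚ Y} ⟩
        pureₜ {(X ⊗ₚ unitₚ) ⊗ₚ Y} {X ⊗ₚ Y} ((A.id ⊗₁ S.λ⇒) A.∘ S.α⇒)
          ≈⟨ pureₜ-cong {(X ⊗ₚ unitₚ) ⊗ₚ Y} {X ⊗ₚ Y} S.triangle ⟩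
        pureₜ {(X ⊗ₚ unitₚ) ⊗ₚ Y} {X ⊗ₚ Y} (S.ρ⇒ ⊗₁ A.id)
          ≈⟨ pureₜ⊗id {X ⊗ₚ unitₚ} {X} {Y} ⟨
        pureₜ {X ⊗ₚ unitₚ} {X} S.ρ⇒ ⊗ₜ P.id {Y} ∎

      pure₃ : ∀ {V W X Y} {c : obj X ⁺ A.⇒ obj Y ⁺} {b : obj W ⁺ A.⇒ obj X ⁺}
              {a : obj V ⁺ A.⇒ obj W ⁺} {h : X P.⇒ Y} {g : W P.⇒ X} {f : V P.⇒ W} →
              h P.≈ pureₜ {X} {Y} c → g P.≈ pureₜ {W} {X} b → f P.≈ pureₜ {V} {W} a →
              h P.∘ (g P.∘ f) P.≈ pureₜ {V} {Y} (c A.∘ (b A.∘ a))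
      pure₃ {V} {W} {X} {Y} {c} {b} {a} {h} {g} {f} r q p = begin
        h P.∘ (g P.∘ f)
          ≈⟨ P.∘-resp-≈ {g = h} {pureₜ {X} {Y} c} {g P.∘ f} {g′ P.∘ f′} r
               (P.∘-resp-≈ {g = g} {g′} {f} {f′} q p) ⟩
        pureₜ {X} {Y} c P.∘ (g′ P.∘ f′)
          ≈⟨ P.∘-resp-≈ʳ {g = pureₜ {X} {Y} c} {g′ P.∘ f′} {pureₜ {V} {X} (b A.∘ a)}
               (pureₜ-∘ {V} {W} {X}) ⟩
        pureₜ {X} {Y} c P.∘ pureₜ {V} {X} (b A.∘ a)
          ≈⟨ pureₜ-∘ {V} {X} {Y} ⟩
        pureₜ {V} {Y} (c A.∘ (b A.∘ a)) ∎
        where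
        g′ = pureₜ {W} {X} b
        f′ = pureₜ {V} {W} a

      pentagonₜ : ∀ W X Y Z →
        (P.id {W} ⊗ₜ αₜ X Y Z) P.∘ (αₜ W (X ⊗ₚ Y) Z P.∘ (αₜ W X Y ⊗ₜ P.id {Z})) P.≈
        αₜ W X (Y ⊗ₚ Z) P.∘ αₜ (W ⊗ₚ X) Y Z
      pentagonₜ W X Y Z = begin
        (P.id {W} ⊗ₜ αₜ X Y Z) P.∘ (αₜ W (X ⊗ₚ Y) Z P.∘ (αₜ W X Y ⊗ₜ P.id {Z}))
          ≈⟨ pure₃ {V} {(W ⊗ₚ (X ⊗ₚ Y)) ⊗ₚ Z} {W ⊗ₚ ((X ⊗ₚ Y) ⊗ₚ Z)} {U}
               {h = P.id {W} ⊗ₜ αₜ X Y Z} {αₜ W (X ⊗ₚ Y) Z} {αₜ W X Y ⊗ₜ P.id {Z}}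
               (id⊗pureₜ {W} {(X ⊗ₚ Y) ⊗ₚ Z} {X ⊗ₚ (Y ⊗ₚ Z)}) A.≈.refl
               (pureₜ⊗id {(W ⊗ₚ X) ⊗ₚ Y} {W ⊗ₚ (X ⊗ₚ Y)} {Z}) ⟩
        pureₜ {V} {U} ((A.id ⊗₁ S.α⇒) A.∘ (S.α⇒ A.∘ (S.α⇒ ⊗₁ A.id)))
          ≈⟨ pureₜ-cong {V} {U} S.pentagon ⟩
        pureₜ {V} {U} (S.α⇒ A.∘ S.α⇒)
          ≈⟨ pureₜ-∘ {V} {(W ⊗ₚ X) ⊗ₚ (Y ⊗ₚ Z)} {U} ⟨
        αₜ W X (Y ⊗ₚ Z) P.∘ αₜ (W ⊗ₚ X) Y Z ∎
        where
        V = ((W ⊗ₚ X) ⊗ₚ Y) ⊗ₚ Z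
        U = W ⊗ₚ (X ⊗ₚ (Y ⊗ₚ Z))

      braidₜ-braidₜ : ∀ X Y → braidₜ Y X P.∘ braidₜ X Y P.≈ P.id {X ⊗ₚ Y}
      braidₜ-braidₜ X Y = begin
        braidₜ Y X P.∘ braidₜ X Y
          ≈⟨ pureₜ-∘ {X ⊗ₚ Y} {Y ⊗ₚ X} {X ⊗ₚ Y} ⟩
        pureₜ {X ⊗ₚ Y} {X ⊗ₚ Y} (S.braid A.∘ S.braid)
          ≈⟨ pureₜ-cong {X ⊗ₚ Y} {X ⊗ₚ Y} S.braid-braid ⟩
        pureₜ {X ⊗ₚ Y} {X ⊗ₚ Y} A.id
          ≈⟨ pureₜ-id {X ⊗ₚ Y} ⟩
        P.id {X ⊗ₚ Y} ∎

      hexagonₜ : ∀ X Y Z →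
        (P.id {Y} ⊗ₜ braidₜ X Z) P.∘ (αₜ Y X Z P.∘ (braidₜ X Y ⊗ₜ P.id {Z})) P.≈
        αₜ Y Z X P.∘ (braidₜ X (Y ⊗ₚ Z) P.∘ αₜ X Y Z)
      hexagonₜ X Y Z = begin
        (P.id {Y} ⊗ₜ braidₜ X Z) P.∘ (αₜ Y X Z P.∘ (braidₜ X Y ⊗ₜ P.id {Z}))
          ≈⟨ pure₃ {V} {(Y ⊗ₚ X) ⊗ₚ Z} {Y ⊗ₚ (X ⊗ₚ Z)} {U}
               {h = P.id {Y} ⊗ₜ braidₜ X Z} {αₜ Y X Z} {braidₜ X Y ⊗ₜ P.id {Z}}
               (id⊗pureₜ {Y} {X ⊗ₚ Z} {Z ⊗ₚ X}) A.≈.refl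
               (pureₜ⊗id {X ⊗ₚ Y} {Y ⊗ₚ X} {Z}) ⟩
        pureₜ {V} {U} ((A.id ⊗₁ S.braid) A.∘ (S.α⇒ A.∘ (S.braid ⊗₁ A.id)))
          ≈⟨ pureₜ-cong {V} {U} S.hexagon ⟩
        pureₜ {V} {U} (S.α⇒ A.∘ (S.braid A.∘ S.α⇒))
          ≈⟨ pure₃ {V} {X ⊗ₚ (Y ⊗ₚ Z)} {(Y ⊗ₚ Z) ⊗ₚ X} {U}
               {h = αₜ Y Z X} {braidₜ X (Y ⊗ₚ Z)} {αₜ X Y Z}
               A.≈.refl A.≈.refl A.≈.refl ⟨
        αₜ Y Z X P.∘ (braidₜ X (Y ⊗ₚ Z) P.∘ αₜ X Y Z) ∎
        where
        V = (X ⊗ₚ Y) ⊗ₚ Z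
        U = Y ⊗ₚ (Z ⊗ₚ X)

record LNLCoadjunction {oA ℓA eA oB ℓB eB oM ℓM eM : Level}
                       {𝒜 : Category oA ℓA eA} {ℬ : Category oB ℓB eB}
                       (S : Monoidal 𝒜) (R : Functor ℬ 𝒜)
                       (ℳ : Category oM ℓM eM) (prod : FiniteProducts ℳ) :
                       Set (oA ⊔ ℓA ⊔ eA ⊔ oB ⊔ ℓB ⊔ eB ⊔ oM ⊔ ℓM ⊔ eM) where
  private
    module A = Category 𝒜
    module B = Category ℬ
    module M = Category ℳ
    module R = Functor R
  field
    Lin        : Functor ℳ 𝒜
    Lin-strong : StrongMonoidal (FiniteProducts.cartesianMonoidal prod) S Lin
    Mult       : Functor ℬ ℳ
  module Lin = Functor Lin
  module Mult = Functor Mult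
  field
    Ψ-inverse : ∀ X B → Inverse (A.hom-setoid (Lin.F₀ X) (R.F₀ B)) (M.hom-setoid X (Mult.F₀ B))

  Ψ : ∀ {X B} → Lin.F₀ X A.⇒ R.F₀ B → X M.⇒ Mult.F₀ B
  Ψ {X} {B} = Inverse.to (Ψ-inverse X B)

  Ψ⁻¹ : ∀ {X B} → X M.⇒ Mult.F₀ B → Lin.F₀ X A.⇒ R.F₀ B
  Ψ⁻¹ {X} {B} = Inverse.from (Ψ-inverse X B)

  field
    Ψ-naturalˡ : ∀ {X X′ B} (g : Lin.F₀ X A.⇒ R.F₀ B) (f : X′ M.⇒ X) →
                 Ψ (g A.∘ Lin.F₁ f) M.≈ Ψ g M.∘ f
    Ψ-naturalʳ : ∀ {X B B′} (h : B B.⇒ B′) (g : Lin.F₀ X A.⇒ R.F₀ B) →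
                 Ψ (R.F₁ h A.∘ g) M.≈ Mult.F₁ h M.∘ Ψ g

  ε : ∀ {B} → Lin.F₀ (Mult.F₀ B) A.⇒ R.F₀ B
  ε = Ψ⁻¹ M.id

record DirectLNLAdjunction {oM ℓM eM oD ℓD eD : Level}
                           {ℳ : Category oM ℓM eM} (prod : FiniteProducts ℳ)
                           {D : NonAssocCategory oD ℓD eD} (S : SymmetricMonoidal (𝒫ₜ D))
                           (F : BareFunctor (Category.nonAssoc ℳ) D)
                           (G : BareFunctor D (Category.nonAssoc ℳ)) :
                           Set (oM ⊔ ℓM ⊔ eM ⊔ oD ⊔ ℓD ⊔ eD) where
  field
    adjunction     : Adjunction F G
    positive       : IsPositive F
    strongMonoidal : StrongMonoidal (FiniteProducts.cartesianMonoidal prod)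
                                    (SymmetricMonoidal.monoidal S)
                                    (inducedFunctor ℳ adjunction positive)

module _ {oA ℓA eA oB ℓB eB oM ℓM eM : Level}
         {𝒜 : Category oA ℓA eA} {ℬ : Category oB ℓB eB}
         (L : Functor 𝒜 ℬ) (R : Functor ℬ 𝒜)
         (L⊣R : Adjunction (Functor.bare L) (Functor.bare R))
         {S : Monoidal 𝒜} {ℳ : Category oM ℓM eM} {prod : FiniteProducts ℳ}
         (coadj : LNLCoadjunction S R ℳ prod) where
  private
    module A = Category 𝒜
    module B = Category ℬ
    module M = Category ℳ
    module R = Functor R
    open Adjunction L⊣R
    open AdjunctionProperties L R L⊣R hiding (adjunctionMonad)
    open LNLCoadjunction coadj hiding (Lin; Mult)
    module Lin = LNLCoadjunction.Lin coadj
    module Mult = LNLCoadjunction.Mult coadj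
    𝒟 = dupl L R L⊣R
    Hom = DuplHom L R L⊣R
    _⁻′ = _⁻ L R L⊣R

  Linᵈ : BareFunctor M.nonAssoc 𝒟
  Linᵈ = record
    { F₀       = λ X → inj₁ (Lin.F₀ X)
    ; F₁       = λ f → η A.∘ Lin.F₁ f
    ; F-resp-≈ = λ p → A.∘-resp-≈ʳ (Lin.F-resp-≈ p)
    ; F-id     = A.≈.trans (A.∘-resp-≈ʳ Lin.F-id) A.identityʳ
    }

  Mult⁻₁ : ∀ X Y → Hom X Y → Mult.F₀ (X ⁻′) M.⇒ Mult.F₀ (Y ⁻′)
  Mult⁻₁ (inj₁ X) Y f = Mult.F₁ (♭ f)
  Mult⁻₁ (inj₂ X) Y f = Ψ (f A.∘ ε)

  Mult⁻ : BareFunctor 𝒟 M.nonAssoc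
  Mult⁻ = record
    { F₀       = λ X → Mult.F₀ (X ⁻′)
    ; F₁       = λ {X} {Y} → Mult⁻₁ X Y
    ; F-resp-≈ = λ {X} {Y} → resp X Y
    ; F-id     = λ {X} → identity X
    }
    where
    resp : ∀ X Y {f g : Hom X Y} → f A.≈ g → Mult⁻₁ X Y f M.≈ Mult⁻₁ X Y g
    resp (inj₁ X) Y p = Mult.F-resp-≈ (♭-cong p)
    resp (inj₂ X) Y p = Inverse.to-cong (Ψ-inverse _ _) (A.∘-resp-≈ˡ p)

    identity : ∀ X → Mult⁻₁ X X (NonAssocCategory.id 𝒟 {X}) M.≈ M.id
    identity (inj₁ X) = M.≈.trans (Mult.F-resp-≈ (♭♯ B.id)) Mult.F-id
    identity (inj₂ X) = M.≈.trans (Inverse.to-cong (Ψ-inverse _ _) A.identityˡ)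
                                  (Inverse.strictlyInverseˡ (Ψ-inverse _ _) M.id)

{-# OPTIONS --safe #-}

-- Ψ itself is the adjunction between Lin and Mult⁻, and objects of 𝒜 are
-- positive in the duploid.  Since a ↦ η ∘ a turns composition and tensor of 𝒜
-- into those of 𝒫ₜ, it carries the strong monoidal structure of
-- Lin : ℳ → 𝒜 over to Lin : ℳ → 𝒫ₜ.
module Submission where

open import Defs
open import Level using (Level)
open import Data.Sum.Base using (inj₁; inj₂)
open import Function.Bundles using (Inverse)

module LNLCoadjunctionProperties
  {oA ℓA eA oB ℓB eB oM ℓM eM : Level}
  {𝒜 : Category oA ℓA eA} {ℬ : Category oB ℓB eB}
  {S : Monoidal 𝒜} {R : Functor ℬ 𝒜}
  {ℳ : Category oM ℓM eM} {prod : FiniteProducts ℳ}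
  (coadj : LNLCoadjunction S R ℳ prod) where
  private
    module A = Category 𝒜
    module M = Category ℳ
    module R = Functor R
  open LNLCoadjunction coadj

  Ψ-cong : ∀ {X B} {g h : Lin.F₀ X A.⇒ R.F₀ B} → g A.≈ h → Ψ g M.≈ Ψ h
  Ψ-cong = Inverse.to-cong (Ψ-inverse _ _)

  Ψ-injective : ∀ {X B} {g h : Lin.F₀ X A.⇒ R.F₀ B} → Ψ g M.≈ Ψ h → g A.≈ h
  Ψ-injective {g = g} {h} p = begin
    g          ≈⟨ Inverse.strictlyInverseʳ (Ψ-inverse _ _) g ⟨
    Ψ⁻¹ (Ψ g)  ≈⟨ Inverse.from-cong (Ψ-inverse _ _) p ⟩
    Ψ⁻¹ (Ψ h)  ≈⟨ Inverse.strictlyInverseʳ (Ψ-inverse _ _) h ⟩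
    h          ∎
    where open A.≈-Reasoning

  -- The triangle law of `ε`: under `Ψ`, naturality in `X` applies, and `Ψ ε` is the identity.
  ε∘LinΨ : ∀ {X B} (h : Lin.F₀ X A.⇒ R.F₀ B) → ε A.∘ Lin.F₁ (Ψ h) A.≈ h
  ε∘LinΨ h = Ψ-injective (begin
    Ψ (ε A.∘ Lin.F₁ (Ψ h))  ≈⟨ Ψ-naturalˡ ε (Ψ h) ⟩
    Ψ ε M.∘ Ψ h             ≈⟨ M.∘-resp-≈ˡ (Inverse.strictlyInverseˡ (Ψ-inverse _ _) M.id) ⟩
    M.id M.∘ Ψ h            ≈⟨ M.identityˡ ⟩
    Ψ h                     ∎)
    where open M.≈-Reasoning

  -- Naturality of `Ψ` in `B` covers only maps `R.F₁ k`, whereas `g` is an arbitrary morphism of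
  -- `𝒜`. Factoring `h` through `ε` reduces the claim to naturality in `X`.
  Ψ-∘ : ∀ {X B B′} (g : R.F₀ B A.⇒ R.F₀ B′) (h : Lin.F₀ X A.⇒ R.F₀ B) →
        Ψ (g A.∘ h) M.≈ Ψ (g A.∘ ε) M.∘ Ψ h
  Ψ-∘ g h = begin
    Ψ (g A.∘ h)                     ≈⟨ Ψ-cong (A.pullʳ (ε∘LinΨ h)) ⟨
    Ψ ((g A.∘ ε) A.∘ Lin.F₁ (Ψ h))  ≈⟨ Ψ-naturalˡ (g A.∘ ε) (Ψ h) ⟩
    Ψ (g A.∘ ε) M.∘ Ψ h             ∎
    where open M.≈-Reasoning

module _
  {oA ℓA eA oB ℓB eB oM ℓM eM : Level}
  {𝒜 : Category oA ℓA eA} {ℬ : Category oB ℓB eB}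
  (S : SymmetricMonoidal 𝒜) (L : Functor 𝒜 ℬ) (R : Functor ℬ 𝒜)
  (L⊣R : Adjunction (Functor.bare L) (Functor.bare R))
  (str : Strength (SymmetricMonoidal.monoidal S) (adjunctionMonad L R L⊣R)) where
  private
    module A = Category 𝒜
    module L = Functor L
    module R = Functor R
    module S = SymmetricMonoidal S
    open S using (_⊗₀_; _⊗₁_)
    open Adjunction L⊣R using (η)
    open AdjunctionProperties L R L⊣R hiding (adjunctionMonad)
    open DoubleStrength S {adjunctionMonad L R L⊣R} str using (dst; dst-η)

  -- Composition in the duploid through an object of `𝒜` is Kleisli composition, and the unit law
  -- cancels the inner `η`. Taking equations as hypotheses lets `*-pure` and `dst-pure` be nested
  -- along the shape of a composite.
  *-pure : ∀ {X Y Z} {g : Y A.⇒ R.F₀ (L.F₀ Z)} {f : X A.⇒ R.F₀ (L.F₀ Y)}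
           {b : Y A.⇒ Z} {a : X A.⇒ Y} →
           g A.≈ η A.∘ b → f A.≈ η A.∘ a → g * A.∘ f A.≈ η A.∘ (b A.∘ a)
  *-pure {g = g} {f} {b} {a} q p = begin
    g * A.∘ f                   ≈⟨ A.∘-resp-≈ (*-cong q) p ⟩
    (η A.∘ b) * A.∘ (η A.∘ a)   ≈⟨ *∘η∘ ⟩
    (η A.∘ b) A.∘ a             ≈⟨ A.assoc ⟩
    η A.∘ (b A.∘ a)             ∎
    where open A.≈-Reasoning

  dst-pure : ∀ {X X′ Y Y′} {f : X A.⇒ R.F₀ (L.F₀ X′)} {g : Y A.⇒ R.F₀ (L.F₀ Y′)}
             {a : X A.⇒ X′} {b : Y A.⇒ Y′} →
             f A.≈ η A.∘ a → g A.≈ η A.∘ b → dst A.∘ (f ⊗₁ g) A.≈ η A.∘ (a ⊗₁ b)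
  dst-pure {f = f} {g} {a} {b} p q = begin
    dst A.∘ (f ⊗₁ g)                 ≈⟨ A.∘-resp-≈ʳ (S.⊗-resp-≈ p q) ⟩
    dst A.∘ ((η A.∘ a) ⊗₁ (η A.∘ b)) ≈⟨ A.∘-resp-≈ʳ S.⊗-∘ ⟩
    dst A.∘ ((η ⊗₁ η) A.∘ (a ⊗₁ b))  ≈⟨ A.pullˡ dst-η ⟩
    η A.∘ (a ⊗₁ b)                   ∎
    where open A.≈-Reasoning

  -- Puts the duploid identity on an object of `𝒜` into the form that `dst-pure` expects.
  η≈η∘id : ∀ {X} → η {X} A.≈ η A.∘ A.id
  η≈η∘id = A.≈.sym A.identityʳ

  module _ {ℳ : Category oM ℓM eM} (prod : FiniteProducts ℳ)
           (coadj : LNLCoadjunction S.monoidal R ℳ prod) where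
    private
      open LNLCoadjunction coadj hiding (module Lin)
      open LNLCoadjunctionProperties coadj
      module Lin where
        open LNLCoadjunction.Lin coadj public
        open StrongMonoidal Lin-strong public

    Lin⊣Mult⁻ : Adjunction (Linᵈ L R L⊣R coadj) (Mult⁻ L R L⊣R coadj)
    Lin⊣Mult⁻ = record
      { φ          = λ X Y → Ψ-inverse X (_⁻ L R L⊣R Y)
      -- The split is on the middle object. In `𝒜` the composite is `R.F₁ (♭ g) ∘ h`, so naturality
      -- in `B` applies; in `ℬ` it is `g ∘ h` with a `g` that need not come from `R`, hence `Ψ-∘`.
      ; φ-naturalʳ = λ { {B = inj₁ Y} g h → Ψ-naturalʳ _ h
                       ; {B = inj₂ Y} g h → Ψ-∘ g h }
      -- Here the middle object lies in `𝒜`, so the composite is `h * ∘ (η ∘ Lin.F₁ f)`, which the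
      -- unit law reduces to `h ∘ Lin.F₁ f`.
      ; φ-naturalˡ = λ h f → Category.≈.trans ℳ (Ψ-cong *∘η∘) (Ψ-naturalˡ h f)
      }

    Lin-positive : IsPositive (Linᵈ L R L⊣R coadj)
    Lin-positive X = inj₁-positive L R L⊣R (Lin.F₀ X)

    Linₜ-strong : StrongMonoidal (FiniteProducts.cartesianMonoidal prod)
                    (SymmetricMonoidal.monoidal (𝒫ₜ-symmetricMonoidal L R L⊣R S str))
                    (inducedFunctor ℳ Lin⊣Mult⁻ Lin-positive)
    Linₜ-strong = record
      { unit-iso  = pureₜ-iso L R L⊣R S str Lin.unit-iso
      ; ⊗-iso     = λ X Y → pureₜ-iso L R L⊣R S str (Lin.⊗-iso X Y)
      -- All objects involved lie in `𝒜`, so both sides are built from maps `η ∘ a` by Kleisli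
      -- composition and double strength. Each collapses to a single `η ∘ a`, and the law of `Lin`
      -- in `𝒜` equates the two `a`.
      ; m-natural = equate (*-pure refl (dst-pure refl refl)) (*-pure refl refl)
                      Lin.m-natural
      ; m-assoc   = equate (*-pure refl (*-pure refl (dst-pure refl η≈η∘id)))
                      (*-pure refl (*-pure (dst-pure η≈η∘id refl) refl)) Lin.m-assoc
      ; m-unitˡ   = equate (*-pure refl (*-pure refl (dst-pure refl η≈η∘id))) refl
                      Lin.m-unitˡ
      ; m-unitʳ   = equate (*-pure refl (*-pure refl (dst-pure η≈η∘id refl))) refl
                      Lin.m-unitʳ
      }
      where
      refl : ∀ {X Y} {f : X A.⇒ Y} → f A.≈ f
      refl = A.≈.refl

      equate : ∀ {X Y} {f g : X A.⇒ R.F₀ (L.F₀ Y)} {a b : X A.⇒ Y} →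
               f A.≈ η A.∘ a → g A.≈ η A.∘ b → a A.≈ b → f A.≈ g
      equate p q r = A.≈.trans p (A.≈.trans (A.∘-resp-≈ʳ r) (A.≈.sym q))

proposition37 : {oA ℓA eA oB ℓB eB oM ℓM eM : Level}
    {𝒜 : Category oA ℓA eA} {ℬ : Category oB ℓB eB}
    (S : SymmetricMonoidal 𝒜) (L : Functor 𝒜 ℬ) (R : Functor ℬ 𝒜)
    (L⊣R : Adjunction (Functor.bare L) (Functor.bare R))
    (str : Strength (SymmetricMonoidal.monoidal S) (adjunctionMonad L R L⊣R))
    {ℳ : Category oM ℓM eM} (prod : FiniteProducts ℳ)
    (coadj : LNLCoadjunction (SymmetricMonoidal.monoidal S) R ℳ prod) →
    DirectLNLAdjunction prod (𝒫ₜ-symmetricMonoidal L R L⊣R S str)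
      (Linᵈ L R L⊣R coadj) (Mult⁻ L R L⊣R coadj)
proposition37 S L R L⊣R str prod coadj = record
  { adjunction     = Lin⊣Mult⁻ S L R L⊣R str prod coadj
  ; positive       = Lin-positive S L R L⊣R str prod coadj
  ; strongMonoidal = Linₜ-strong S L R L⊣R str prod coadj
  }
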